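{- Let $\mathcal L_{\mathrm{LE}}$ be any LE-language. Every $\mathcal L_{\mathrm{LE}}$-inequality on which ALBA succeeds pivotally is canonical; that is, if some pivotal execution of ALBA succeeds on $\phi\le\psi$, then for every $\mathcal L_{\mathrm{LE}}$-algebra $\mathbb A$, $\mathbb A\models\phi\le\psi$ implies $\mathbb A^\delta\models\phi\le\psi$, where $\mathbb A^\delta$ is the canonical extension of $\mathbb A$.
   Context: **Languages and algebras.** An order-type over $n$ is a tuple $\varepsilon\in\{1,\partial\}^n$; $1^\partial=\partial$, $\partial^\partial=1$. An LE-language $\mathcal L_{\mathrm{LE}}$ is given by a denumerable set $\mathsf{PROP}$ of propositional variables and disjoint sets $\mathcal F,\mathcal G$ of connectives, each $h\in\mathcal F\cup\mathcal G$ having an arity $n_h$ and an order-type $\varepsilon_h$ over $n_h$. Terms: $\phi::=p\mid\bot\mid\top\mid\phi\wedge\phi\mid\phi\vee\phi\mid f(\overline\phi)\mid g(\overline\phi)$. An $\mathcal L_{\mathrm{LE}}$-algebra (normal lattice expansion, LE) is a bounded lattice with an $n_h$-ary operation for each $h\in\mathcal F\cup\mathcal G$ such that: each $f\in\mathcal F$ preserves finite (including empty) joins in each coordinate $i$ with $\varepsilon_f(i)=1$ and sends finite (including empty) meets to joins in each coordinate with $\varepsilon_f(i)=\partial$; each $g\in\mathcal G$ preserves finite (including empty) meets in each coordinate with $\varepsilon_g(i)=1$ and sends finite (including empty) joins to meets in each coordinate with $\varepsilon_g(i)=\partial$. $\mathbb A\models\phi\le\psi$ means that the inequality holds under all assignments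 of elements of $\mathbb A$ to propositional variables. **Canonical extension.** The canonical extension of a bounded lattice $L$ is the (unique up to isomorphism fixing $L$) complete lattice $L^\delta$ containing $L$ as a sublattice which is dense (every element of $L^\delta$ is both a join of meets and a meet of joins of elements of $L$) and compact (for all $S,T\subseteq L$, if $\bigwedge S\le\bigvee T$ then $\bigwedge S'\le\bigvee T'$ for some finite $S'\subseteq S$, $T'\subseteq T$). Closed elements $K(L^\delta)$ are the meets, open elements $O(L^\delta)$ the joins, of subsets of $L$. Let $\le^1$ be $\le$, $\le^\partial$ be $\ge$, $K^1=O^\partial=K(L^\delta)$, $O^1=K^\partial=O(L^\delta)$; $\le^{\varepsilon}$ on tuples is coordinatewise. The canonical extension $\mathbb A^\delta$ of an LE $\mathbb A$ with lattice $L$ is $L^\delta$ with each $f\in\mathcal F$ interpreted by $f^\sigma$ and each $g\in\mathcal G$ by $g^\pi$, where $f^\sigma(\overline k)=\bigwedge\{f(\overline a)\mid\overline a\in L^{n_f},\overline k\le^{\varepsilon_f}\overline a\}$ for $\overline k\in\prod_iK^{\varepsilon_f(i)}$ and $f^\sigma(\overline u)=\bigvee\{f^\sigma(\overline k)\mid\overline k\in\prod_iK^{\varepsilon_f(i)},\overline k\le^{\varepsilon_f}\overline u\}$ in general; $g^\pi(\overline o)=\bigvee\{g(\overline a)\mid\overline a\in L^{n_g},\overline a\le^{\varepsilon_g}\overline o\}$ for $\overline o\in\prod_iO^{\varepsilon_g(i)}$ and $g^\pi(\overline v)=\bigwedge\{g^\pi(\overline o)\mid\overline o\in\prod_iO^{\varepsilon_g(i)},\overline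 v\le^{\varepsilon_g}\overline o\}$ in general. **Expanded language.** $\mathcal F^*\supseteq\mathcal F$ and $\mathcal G^*\supseteq\mathcal G$ are obtained by adding, for $f\in\mathcal F$ and $1\le i\le n_f$, an $n_f$-ary connective $f_i^\sharp$ (in $\mathcal G^*$ if $\varepsilon_f(i)=1$, in $\mathcal F^*$ if $\varepsilon_f(i)=\partial$) and, for $g\in\mathcal G$ and $1\le i\le n_g$, an $n_g$-ary connective $g_i^\flat$ (in $\mathcal F^*$ if $\varepsilon_g(i)=1$, in $\mathcal G^*$ if $\varepsilon_g(i)=\partial$). Order-types: for $k=h_i^\sharp$ or $k=h_i^\flat$, if $\varepsilon_h(i)=1$ then $\varepsilon_k(i)=1$ and $\varepsilon_k(j)=\varepsilon_h(j)^\partial$ for $j\ne i$; if $\varepsilon_h(i)=\partial$ then $\varepsilon_k(i)=\partial$ and $\varepsilon_k(j)=\varepsilon_h(j)$ for $j\neq i$. (Intended meaning: $f_i^\sharp$ and $g_i^\flat$ are the residuals/Galois-adjoints of $f$, $g$ in the $i$-th coordinate.) The terms of $\mathcal L_{\mathrm{LE}}^+$ are built from $\mathsf{PROP}$, $\bot,\top$, countably many nominals $\mathbf i,\mathbf j,\dots$ and co-nominals $\mathbf m,\mathbf n,\dots$ using $\wedge,\vee$ and $\mathcal F^*\cup\mathcal G^*$. An expression is pure if it contains no propositional variables. **Signs.** The signed generation tree $+s$ (resp. $-s$) of a term $s$ labels the root of its syntax tree with $+$ (resp. $-$) and propagates: children of $\wedge,\vee$ nodes get the same sign; the $i$-th child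 of a node labelled by a connective $h$ gets the same sign if $\varepsilon_h(i)=1$ and the opposite sign if $\varepsilon_h(i)=\partial$. A term $s$ is positive (negative) in $p$ if all occurrences of $p$ in $+s$ are signed $+$ ($-$). An SLR node is a node $+f$ with $f\in\mathcal F$, $n_f\ge1$, or $-g$ with $g\in\mathcal G$, $n_g\ge1$; a branch is SLR if all its nodes other than its leaf are SLR nodes. $\phi'(!x)$ means that the variable $x$ occurs exactly once in $\phi'$; $\pm x\prec\ast s$ means that $x$ occurs with that sign in $\ast s$. **ALBA.** Input: an $\mathcal L_{\mathrm{LE}}$-inequality $\phi\le\psi$. *Stage 1 (preprocessing).* Exhaustively: replace $\alpha(p)\le\beta(p)$ by $\alpha(\bot)\le\beta(\bot)$ if $\alpha$ is negative and $\beta$ positive in $p$; replace $\gamma(p)\le\delta(p)$ by $\gamma(\top)\le\delta(\top)$ if $\gamma$ is positive and $\delta$ negative in $p$. Then, considering $+$ of the left-hand side and $-$ of the right-hand side, exhaustively distribute positive $f\in\mathcal F$ nodes over $+\vee$ children (coordinates with $\varepsilon_f(i)=1$) and $-\wedge$ children (coordinates with $\varepsilon_f(i)=\partial$), turning them into joins of $f$-terms, and negative $g\in\mathcal G$ nodes over $-\wedge$ children ($\varepsilon_g(i)=1$) and $+\vee$ children ($\varepsilon_g(i)=\partial$), turning them into meets of $g$-terms; and exhaustively apply splitting: $\alpha\le\beta\wedge\gamma$ becomes $\alpha\le\beta$, $\alpha\le\gamma$; $\alpha\vee\beta\le\gamma$ becomes $\alpha\le\gamma$, $\beta\le\gamma$.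 This yields finitely many inequalities $\phi_i'\le\psi_i'$, each giving an initial system $(S_i,\mathsf{Ineq}_i)=(\emptyset,\phi_i'\le\psi_i')$. A system $(S,\mathsf{Ineq})$ (finite set of inequalities, inequality) represents the quasi-inequality "conjunction of $S$ implies $\mathsf{Ineq}$". *Stage 2 (reduction).* Each system is transformed separately by the following reduction rules, on $\mathcal L_{\mathrm{LE}}^+$-inequalities. (Approximation) For $\gamma\in\mathcal L_{\mathrm{LE}}$, $\mathbf j$ ($\mathbf m$) the first nominal (co-nominal) not occurring in the system, and the branch from the indicated occurrence of $x$ to the root being SLR: $(S,\phi'(\gamma/!x)\le\psi)$ becomes $(S\cup\{\mathbf j\le\gamma\},\phi'(\mathbf j/!x)\le\psi)$ if $+x\prec+\phi'(!x)$, or $(S\cup\{\gamma\le\mathbf m\},\phi'(\mathbf m/!x)\le\psi)$ if $-x\prec+\phi'(!x)$; $(S,\phi\le\psi'(\gamma/!x))$ becomes $(S\cup\{\mathbf j\le\gamma\},\phi\le\psi'(\mathbf j/!x))$ if $+x\prec-\psi'(!x)$, or $(S\cup\{\gamma\le\mathbf m\},\phi\le\psi'(\mathbf m/!x))$ if $-x\prec-\psi'(!x)$. (Residuation, replacing an inequality in $S$) For $f\in\mathcal F$: $f(\phi_1,\dots,\phi_i,\dots,\phi_{n_f})\le\psi$ becomes $\phi_i\le f_i^\sharp(\phi_1,\dots,\psi,\dots,\phi_{n_f})$ if $\varepsilon_f(i)=1$, and $f_i^\sharp(\phi_1,\dots,\psi,\dots,\phi_{n_f})\le\phi_i$ if $\varepsilon_f(i)=\partial$.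 For $g\in\mathcal G$: $\psi\le g(\phi_1,\dots,\phi_i,\dots,\phi_{n_g})$ becomes $g_i^\flat(\phi_1,\dots,\psi,\dots,\phi_{n_g})\le\phi_i$ if $\varepsilon_g(i)=1$, and $\phi_i\le g_i^\flat(\phi_1,\dots,\psi,\dots,\phi_{n_g})$ if $\varepsilon_g(i)=\partial$. (Splitting) The splitting rules of Stage 1, applied in $S$. (Right Ackermann) $(\{\alpha_i\le p\mid1\le i\le n\}\cup\{\beta_j(p)\le\gamma_j(p)\mid1\le j\le m\},\mathsf{Ineq})$ becomes $(\{\beta_j(\bigvee_i\alpha_i)\le\gamma_j(\bigvee_i\alpha_i)\mid1\le j\le m\},\mathsf{Ineq})$, provided $p$ does not occur in any $\alpha_i$ or in $\mathsf{Ineq}$, the $\beta_j$ are positive in $p$ and the $\gamma_j$ negative in $p$. (Left Ackermann) $(\{p\le\alpha_i\mid1\le i\le n\}\cup\{\beta_j(p)\le\gamma_j(p)\mid1\le j\le m\},\mathsf{Ineq})$ becomes $(\{\beta_j(\bigwedge_i\alpha_i)\le\gamma_j(\bigwedge_i\alpha_i)\mid1\le j\le m\},\mathsf{Ineq})$, provided $p$ does not occur in any $\alpha_i$ or in $\mathsf{Ineq}$, the $\beta_j$ are negative in $p$ and the $\gamma_j$ positive in $p$. *Stage 3.* ALBA succeeds (in an execution) if every system has been made pure; it then returns the conjunction $\mathsf{ALBA}(\phi\le\psi)$ of the resulting pure quasi-inequalities. Otherwise it fails. *Pivotal executions.* An application of an approximation rule is pivotal if the SLR branch from the root to the node $x$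 is maximal, i.e. the root of the extracted subterm $\gamma$ (with its inherited sign) is not itself an SLR node. An execution is pivotal if approximation rules are applied only pivotally. -}

module Defs where

open import Level using (Level; _⊔_; Lift; lower) renaming (suc to lsuc)
open import Data.Bool.Base using (if_then_else_)
open import Data.Fin.Base using (Fin; zero; suc)
import Data.Fin.Properties as Fin
open import Data.List.Base using (List; []; _∷_; _++_; foldr; map)
open import Data.List.Membership.Propositional using (_∉_)
open import Data.List.Relation.Binary.BagAndSetEquality using (_∼[_]_; set)
open import Data.List.Relation.Unary.All using (All)
open import Data.List.Relation.Unary.Any using (Any)
open import Data.Nat.Base as ℕ using (ℕ)
import Data.Nat.Properties as ℕ
open import Data.Product.Base using (Σ; ∃; ∃₂; _×_; _,_; proj₁; proj₂)
open import Data.Sign.Base using (Sign; +; -; opposite)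
open import Data.Sum.Base using (_⊎_; inj₁; inj₂)
open import Data.Unit.Base using (tt) renaming (⊤ to Unit)
open import Data.Vec.Base as Vec using (Vec; []; _∷_; lookup; _[_]≔_)
open import Data.Vec.Functional as Vector using (Vector)
open import Function.Base using (const; _∘_)
open import Function.Bundles using (_↔_)
open import Function.Properties.Inverse using (↔⇒↣)
open import Relation.Binary.Construct.Closure.ReflexiveTransitive using (Star)
open import Relation.Binary.Definitions using (DecidableEquality)
open import Relation.Binary.Lattice using (BoundedLattice)
open import Relation.Binary.PropositionalEquality using (_≡_; refl; cong)
open import Relation.Binary.Rewriting using (IsNormalForm)
open import Relation.Nullary using (no; does; ¬_)
open import Relation.Nullary.Decidable using (map′; via-injection)
open import Relation.Unary using (Pred)

------------------------------------------------------------------------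
-- Order-types and languages

data Coord : Set where
  𝟙 ∂ : Coord

_^∂ : Coord → Coord
𝟙 ^∂ = ∂
∂ ^∂ = 𝟙

OrderType : ℕ → Set
OrderType n = Fin n → Coord

infixl 7 _·_

_·_ : Sign → Coord → Sign
s · 𝟙 = s
s · ∂ = opposite s

record Language (o : Level) : Set (lsuc o) where
  field
    PROP             : Set o
    PROP-denumerable : PROP ↔ ℕ
    F G              : Set o
    arity            : F ⊎ G → ℕ
    ε                : (h : F ⊎ G) → OrderType (arity h)

  Conn : Set o
  Conn = F ⊎ G

  _≟ₚ_ : DecidableEquality PROP
  _≟ₚ_ = via-injection (↔⇒↣ PROP-denumerable) ℕ._≟_

-- The order-type of both h♯ᵢ and h♭ᵢ, as a function of that of h.

adjointType : ∀ {n} → OrderType n → Fin n → OrderType n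
adjointType ε i j = if does (j Fin.≟ i) then ε i else other (ε i)
  where
  other : Coord → Coord
  other 𝟙 = ε j ^∂
  other ∂ = ε j

module _ {o} (L : Language o) where
  open Language L

  data F* : Set o where
    base : F → F*
    ♯    : (f : F) (i : Fin (arity (inj₁ f))) → ε (inj₁ f) i ≡ ∂ → F*
    ♭    : (g : G) (i : Fin (arity (inj₂ g))) → ε (inj₂ g) i ≡ 𝟙 → F*

  data G* : Set o where
    base : G → G*
    ♯    : (f : F) (i : Fin (arity (inj₁ f))) → ε (inj₁ f) i ≡ 𝟙 → G*
    ♭    : (g : G) (i : Fin (arity (inj₂ g))) → ε (inj₂ g) i ≡ ∂ → G*

  arity* : F* ⊎ G* → ℕ
  arity* (inj₁ (base f))  = arity (inj₁ f)
  arity* (inj₁ (♯ f _ _)) = arity (inj₁ f)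
  arity* (inj₁ (♭ g _ _)) = arity (inj₂ g)
  arity* (inj₂ (base g))  = arity (inj₂ g)
  arity* (inj₂ (♯ f _ _)) = arity (inj₁ f)
  arity* (inj₂ (♭ g _ _)) = arity (inj₂ g)

  ε* : (h : F* ⊎ G*) → OrderType (arity* h)
  ε* (inj₁ (base f))  = ε (inj₁ f)
  ε* (inj₁ (♯ f i _)) = adjointType (ε (inj₁ f)) i
  ε* (inj₁ (♭ g i _)) = adjointType (ε (inj₂ g)) i
  ε* (inj₂ (base g))  = ε (inj₂ g)
  ε* (inj₂ (♯ f i _)) = adjointType (ε (inj₁ f)) i
  ε* (inj₂ (♭ g i _)) = adjointType (ε (inj₂ g)) i

  expand : Language o
  expand = record
    { PROP             = PROP
    ; PROP-denumerable = PROP-denumerable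
    ; F                = F*
    ; G                = G*
    ; arity            = arity*
    ; ε                = ε*
    }

------------------------------------------------------------------------
-- Terms over an arbitrary type X of atoms

data Term {o} (L : Language o) (X : Set o) : Set o where
  atom    : X → Term L X
  ⊥ᵗ ⊤ᵗ   : Term L X
  _∧ᵗ_    : Term L X → Term L X → Term L X
  _∨ᵗ_    : Term L X → Term L X → Term L X
  con     : (h : Language.Conn L) → Vec (Term L X) (Language.arity L h) → Term L X

infix  5 _≼_
infixr 7 _∧ᵗ_
infixr 6 _∨ᵗ_

record Ineq {o} (L : Language o) (X : Set o) : Set o where
  constructor _≼_
  field
    lhs rhs : Term L X

open Ineq public

module _ {o} {L : Language o} {X : Set o} where
  open Language L

  -- Occ x σ τ t is the type of occurrences of x that carry the sign σ in the
  -- signed generation tree of t whose root is labelled τ.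

  data Occ (x : X) (σ : Sign) : Sign → Term L X → Set o where
    here : Occ x σ σ (atom x)
    ∧ˡ   : ∀ {τ s t} → Occ x σ τ s → Occ x σ τ (s ∧ᵗ t)
    ∧ʳ   : ∀ {τ s t} → Occ x σ τ t → Occ x σ τ (s ∧ᵗ t)
    ∨ˡ   : ∀ {τ s t} → Occ x σ τ s → Occ x σ τ (s ∨ᵗ t)
    ∨ʳ   : ∀ {τ s t} → Occ x σ τ t → Occ x σ τ (s ∨ᵗ t)
    arg  : ∀ {τ} h {ts} i → Occ x σ (τ · ε h i) (lookup ts i) → Occ x σ τ (con h ts)

  _OccursIn_ : X → Term L X → Set o
  x OccursIn t = ∃ λ σ → Occ x σ + t

  _OccursInIneq_ : X → Ineq L X → Set o
  x OccursInIneq (s ≼ t) = x OccursIn s ⊎ x OccursIn t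

  PositiveIn NegativeIn : X → Term L X → Set o
  PositiveIn x t = ∀ {σ} → Occ x σ + t → σ ≡ +
  NegativeIn x t = ∀ {σ} → Occ x σ + t → σ ≡ -

  module Substitution (_≟_ : DecidableEquality X) where

    substitute    : Term L X → X → Term L X → Term L X
    substituteVec : ∀ {n} → Vec (Term L X) n → X → Term L X → Vec (Term L X) n

    substitute (atom y)   x s = if does (y ≟ x) then s else atom y
    substitute ⊥ᵗ         x s = ⊥ᵗ
    substitute ⊤ᵗ         x s = ⊤ᵗ
    substitute (t ∧ᵗ u)   x s = substitute t x s ∧ᵗ substitute u x s
    substitute (t ∨ᵗ u)   x s = substitute t x s ∨ᵗ substitute u x s
    substitute (con h ts) x s = con h (substituteVec ts x s)

    substituteVec []       x s = []
    substituteVec (t ∷ ts) x s = substitute t x s ∷ substituteVec ts x s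

    substituteIneq : Ineq L X → X → Term L X → Ineq L X
    substituteIneq (t ≼ u) x s = substitute t x s ≼ substitute u x s

  ⋁ᵗ ⋀ᵗ : List (Term L X) → Term L X
  ⋁ᵗ []               = ⊥ᵗ
  ⋁ᵗ (t ∷ [])         = t
  ⋁ᵗ (t ∷ ts@(_ ∷ _)) = t ∨ᵗ ⋁ᵗ ts
  ⋀ᵗ []               = ⊤ᵗ
  ⋀ᵗ (t ∷ [])         = t
  ⋀ᵗ (t ∷ ts@(_ ∷ _)) = t ∧ᵗ ⋀ᵗ ts

  data Splits : Ineq L X → Ineq L X → Ineq L X → Set o where
    split-∧ : ∀ {α β γ} → Splits (α ≼ β ∧ᵗ γ) (α ≼ β) (α ≼ γ)
    split-∨ : ∀ {α β γ} → Splits (α ∨ᵗ β ≼ γ) (α ≼ γ) (β ≼ γ)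

------------------------------------------------------------------------
-- Stage 1

module Preprocessing {o} (L : Language o) where
  open Language L
  open Substitution {L = L} _≟ₚ_

  -- Both rules fix an inequality in which p does not occur, so p is required
  -- to occur; otherwise no inequality would be irreducible.

  data _⟶ᵉ_ : Ineq L PROP → Ineq L PROP → Set o where
    elim-⊥ : ∀ {α β} p → p OccursInIneq (α ≼ β) →
             NegativeIn p α → PositiveIn p β →
             (α ≼ β) ⟶ᵉ substituteIneq (α ≼ β) p ⊥ᵗ
    elim-⊤ : ∀ {γ δ} p → p OccursInIneq (γ ≼ δ) →
             PositiveIn p γ → NegativeIn p δ →
             (γ ≼ δ) ⟶ᵉ substituteIneq (γ ≼ δ) p ⊤ᵗ

  -- Distributes τ s t: one distribution step anywhere in the tree of s with
  -- root sign τ yields t.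

  data Distributes : Sign → Term L PROP → Term L PROP → Set o where
    f-𝟙 : ∀ f {ts} i {s t} → ε (inj₁ f) i ≡ 𝟙 → lookup ts i ≡ s ∨ᵗ t →
          Distributes + (con (inj₁ f) ts)
            (con (inj₁ f) (ts [ i ]≔ s) ∨ᵗ con (inj₁ f) (ts [ i ]≔ t))
    f-∂ : ∀ f {ts} i {s t} → ε (inj₁ f) i ≡ ∂ → lookup ts i ≡ s ∧ᵗ t →
          Distributes + (con (inj₁ f) ts)
            (con (inj₁ f) (ts [ i ]≔ s) ∨ᵗ con (inj₁ f) (ts [ i ]≔ t))
    g-𝟙 : ∀ g {ts} i {s t} → ε (inj₂ g) i ≡ 𝟙 → lookup ts i ≡ s ∧ᵗ t →
          Distributes - (con (inj₂ g) ts)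
            (con (inj₂ g) (ts [ i ]≔ s) ∧ᵗ con (inj₂ g) (ts [ i ]≔ t))
    g-∂ : ∀ g {ts} i {s t} → ε (inj₂ g) i ≡ ∂ → lookup ts i ≡ s ∨ᵗ t →
          Distributes - (con (inj₂ g) ts)
            (con (inj₂ g) (ts [ i ]≔ s) ∧ᵗ con (inj₂ g) (ts [ i ]≔ t))
    ∧ˡ  : ∀ {τ s s′ t} → Distributes τ s s′ → Distributes τ (s ∧ᵗ t) (s′ ∧ᵗ t)
    ∧ʳ  : ∀ {τ s t t′} → Distributes τ t t′ → Distributes τ (s ∧ᵗ t) (s ∧ᵗ t′)
    ∨ˡ  : ∀ {τ s s′ t} → Distributes τ s s′ → Distributes τ (s ∨ᵗ t) (s′ ∨ᵗ t)
    ∨ʳ  : ∀ {τ s t t′} → Distributes τ t t′ → Distributes τ (s ∨ᵗ t) (s ∨ᵗ t′)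
    arg : ∀ {τ} h {ts} i {t′} → Distributes (τ · ε h i) (lookup ts i) t′ →
          Distributes τ (con h ts) (con h (ts [ i ]≔ t′))

  data _⟶ᵈ_ : Ineq L PROP → Ineq L PROP → Set o where
    left  : ∀ {s s′ t} → Distributes + s s′ → (s ≼ t) ⟶ᵈ (s′ ≼ t)
    right : ∀ {s t t′} → Distributes - t t′ → (s ≼ t) ⟶ᵈ (s ≼ t′)

  data _⟶ˢ_ : List (Ineq L PROP) → List (Ineq L PROP) → Set o where
    split : ∀ es {e e₁ e₂} es′ → Splits e e₁ e₂ →
            (es ++ e ∷ es′) ⟶ˢ (es ++ e₁ ∷ e₂ ∷ es′)

  Preprocesses : Ineq L PROP → List (Ineq L PROP) → Set o
  Preprocesses e es = ∃₂ λ e₁ e₂ →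
    (Star _⟶ᵉ_ e e₁ × IsNormalForm _⟶ᵉ_ e₁) ×
    (Star _⟶ᵈ_ e₁ e₂ × IsNormalForm _⟶ᵈ_ e₂) ×
    (Star _⟶ˢ_ (e₂ ∷ []) es × IsNormalForm _⟶ˢ_ es)

------------------------------------------------------------------------
-- The expanded language

data Atom⁺ {o} (P : Set o) : Set o where
  prop : P → Atom⁺ P
  nom  : ℕ → Atom⁺ P
  cnom : ℕ → Atom⁺ P

module _ {o} {P : Set o} where

  atom⁺-≟ : DecidableEquality P → DecidableEquality (Atom⁺ P)
  atom⁺-≟ _≟_ (prop p) (prop q) = map′ (cong prop) (λ { refl → refl }) (p ≟ q)
  atom⁺-≟ _≟_ (nom i)  (nom j)  = map′ (cong nom) (λ { refl → refl }) (i ℕ.≟ j)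
  atom⁺-≟ _≟_ (cnom m) (cnom n) = map′ (cong cnom) (λ { refl → refl }) (m ℕ.≟ n)
  atom⁺-≟ _≟_ (prop _) (nom _)  = no λ ()
  atom⁺-≟ _≟_ (prop _) (cnom _) = no λ ()
  atom⁺-≟ _≟_ (nom _)  (prop _) = no λ ()
  atom⁺-≟ _≟_ (nom _)  (cnom _) = no λ ()
  atom⁺-≟ _≟_ (cnom _) (prop _) = no λ ()
  atom⁺-≟ _≟_ (cnom _) (nom _)  = no λ ()

module Expanded {o} (L : Language o) where
  open Language L

  Term⁺ Ineq⁺ : Set o
  Term⁺ = Term (expand L) (Atom⁺ PROP)
  Ineq⁺ = Ineq (expand L) (Atom⁺ PROP)

  embed    : Term L PROP → Term⁺
  embedVec : ∀ {n} → Vec (Term L PROP) n → Vec Term⁺ n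

  embed (atom p)          = atom (prop p)
  embed ⊥ᵗ                = ⊥ᵗ
  embed ⊤ᵗ                = ⊤ᵗ
  embed (s ∧ᵗ t)          = embed s ∧ᵗ embed t
  embed (s ∨ᵗ t)          = embed s ∨ᵗ embed t
  embed (con (inj₁ f) ts) = con (inj₁ (base f)) (embedVec ts)
  embed (con (inj₂ g) ts) = con (inj₂ (base g)) (embedVec ts)

  embedVec []       = []
  embedVec (t ∷ ts) = embed t ∷ embedVec ts

  embedIneq : Ineq L PROP → Ineq⁺
  embedIneq (s ≼ t) = embed s ≼ embed t

  PureIneq : Ineq⁺ → Set o
  PureIneq e = ∀ p → ¬ (prop p OccursInIneq e)

------------------------------------------------------------------------
-- Stages 2 and 3

module ALBA {o} (L : Language o) where
  open Language L
  open Expanded L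
  open Substitution {L = expand L} (atom⁺-≟ _≟ₚ_)

  data SLRNode : Sign → Term⁺ → Set o where
    +f : ∀ f {ts} → 1 ℕ.≤ arity (inj₁ f) → SLRNode + (con (inj₁ (base f)) ts)
    -g : ∀ g {ts} → 1 ℕ.≤ arity (inj₂ g) → SLRNode - (con (inj₂ (base g)) ts)

  -- One-hole contexts φ'(!x), the hole being x, whose branch from the root to
  -- the hole is SLR; τ and σ are the signs of the root and of the hole.  In
  -- f-node and g-node the i-th entry of ts is a dummy, overwritten by plugging.

  data SLRContext (σ : Sign) : Sign → Set o where
    hole   : SLRContext σ σ
    f-node : ∀ f (ts : Vec Term⁺ (arity (inj₁ f))) i →
             SLRContext σ (+ · ε (inj₁ f) i) → SLRContext σ +
    g-node : ∀ g (ts : Vec Term⁺ (arity (inj₂ g))) i →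
             SLRContext σ (- · ε (inj₂ g) i) → SLRContext σ -

  _⟨_⟩ : ∀ {σ τ} → SLRContext σ τ → Term⁺ → Term⁺
  hole            ⟨ t ⟩ = t
  f-node f ts i C ⟨ t ⟩ = con (inj₁ (base f)) (ts [ i ]≔ (C ⟨ t ⟩))
  g-node g ts i C ⟨ t ⟩ = con (inj₂ (base g)) (ts [ i ]≔ (C ⟨ t ⟩))

  -- The first component is a finite set: lists are used up to _∼[ set ]_.

  System : Set o
  System = List Ineq⁺ × Ineq⁺

  _OccursInSystem_ : Atom⁺ PROP → System → Set o
  x OccursInSystem (S , I) = Any (x OccursInIneq_) S ⊎ x OccursInIneq I

  PureSystem : System → Set o
  PureSystem (S , I) = All PureIneq S × PureIneq I

  FirstFresh : (ℕ → Atom⁺ PROP) → ℕ → System → Set o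
  FirstFresh v n X =
    ¬ (v n OccursInSystem X) × (∀ m → m ℕ.< n → v m OccursInSystem X)

  -- A subterm extracted at a position of sign + (-) is approximated by a
  -- nominal from below (a co-nominal from above), on either side of Ineq.

  approximant : Sign → ℕ → Atom⁺ PROP
  approximant + = nom
  approximant - = cnom

  bound : Sign → ℕ → Term⁺ → Ineq⁺
  bound + n γ = atom (nom n) ≼ γ
  bound - n γ = γ ≼ atom (cnom n)

  data Residuates : Ineq⁺ → Ineq⁺ → Set o where
    f-𝟙 : ∀ f ts ψ i (p : ε (inj₁ f) i ≡ 𝟙) →
          Residuates (con (inj₁ (base f)) ts ≼ ψ)
                     (lookup ts i ≼ con (inj₂ (♯ f i p)) (ts [ i ]≔ ψ))
    f-∂ : ∀ f ts ψ i (p : ε (inj₁ f) i ≡ ∂) →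
          Residuates (con (inj₁ (base f)) ts ≼ ψ)
                     (con (inj₁ (♯ f i p)) (ts [ i ]≔ ψ) ≼ lookup ts i)
    g-𝟙 : ∀ g ts ψ i (p : ε (inj₂ g) i ≡ 𝟙) →
          Residuates (ψ ≼ con (inj₂ (base g)) ts)
                     (con (inj₁ (♭ g i p)) (ts [ i ]≔ ψ) ≼ lookup ts i)
    g-∂ : ∀ g ts ψ i (p : ε (inj₂ g) i ≡ ∂) →
          Residuates (ψ ≼ con (inj₂ (base g)) ts)
                     (lookup ts i ≼ con (inj₂ (♭ g i p)) (ts [ i ]≔ ψ))

  data _⟶_ : System → System → Set o where

    approxˡ : ∀ {S ψ σ} (C : SLRContext σ +) (γ : Term L PROP) n →
              FirstFresh (approximant σ) n (S , (C ⟨ embed γ ⟩ ≼ ψ)) →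
              (S , (C ⟨ embed γ ⟩ ≼ ψ)) ⟶
              (bound σ n (embed γ) ∷ S , (C ⟨ atom (approximant σ n) ⟩ ≼ ψ))

    approxʳ : ∀ {S φ σ} (C : SLRContext σ -) (γ : Term L PROP) n →
              FirstFresh (approximant σ) n (S , (φ ≼ C ⟨ embed γ ⟩)) →
              (S , (φ ≼ C ⟨ embed γ ⟩)) ⟶
              (bound σ n (embed γ) ∷ S , (φ ≼ C ⟨ atom (approximant σ n) ⟩))

    residuation : ∀ {S S₀ I e e′} → S ∼[ set ] (e ∷ S₀) → e ∉ S₀ →
                  Residuates e e′ →
                  (S , I) ⟶ (e′ ∷ S₀ , I)

    splitting : ∀ {S S₀ I e e₁ e₂} → S ∼[ set ] (e ∷ S₀) → e ∉ S₀ →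
                Splits e e₁ e₂ →
                (S , I) ⟶ (e₁ ∷ e₂ ∷ S₀ , I)

    ackermannʳ : ∀ {S I} p (αs : List Term⁺) (βγs : List Ineq⁺) →
                 S ∼[ set ] (map (_≼ atom (prop p)) αs ++ βγs) →
                 All (λ α → ¬ (prop p OccursIn α)) αs →
                 ¬ (prop p OccursInIneq I) →
                 All (λ e → PositiveIn (prop p) (lhs e) × NegativeIn (prop p) (rhs e)) βγs →
                 (S , I) ⟶ (map (λ e → substituteIneq e (prop p) (⋁ᵗ αs)) βγs , I)

    ackermannˡ : ∀ {S I} p (αs : List Term⁺) (βγs : List Ineq⁺) →
                 S ∼[ set ] (map (atom (prop p) ≼_) αs ++ βγs) →
                 All (λ α → ¬ (prop p OccursIn α)) αs →
                 ¬ (prop p OccursInIneq I) →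
                 All (λ e → NegativeIn (prop p) (lhs e) × PositiveIn (prop p) (rhs e)) βγs →
                 (S , I) ⟶ (map (λ e → substituteIneq e (prop p) (⋀ᵗ αs)) βγs , I)

  IsPivotal : ∀ {X Y} → X ⟶ Y → Set o
  IsPivotal (approxˡ {σ = σ} C γ n _)      = ¬ SLRNode σ (embed γ)
  IsPivotal (approxʳ {σ = σ} C γ n _)      = ¬ SLRNode σ (embed γ)
  IsPivotal (residuation _ _ _)            = Lift o Unit
  IsPivotal (splitting _ _ _)              = Lift o Unit
  IsPivotal (ackermannʳ _ _ _ _ _ _ _)     = Lift o Unit
  IsPivotal (ackermannˡ _ _ _ _ _ _ _)     = Lift o Unit

  _⟶ᵖ_ : System → System → Set o
  X ⟶ᵖ Y = Σ (X ⟶ Y) IsPivotal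

SucceedsPivotally : ∀ {o} (L : Language o) → Ineq L (Language.PROP L) → Set o
SucceedsPivotally L e = ∃ λ es → Preprocesses e es ×
  All (λ e′ → ∃ λ X → Star _⟶ᵖ_ ([] , embedIneq e′) X × PureSystem X) es
  where
  open Preprocessing L
  open Expanded L
  open ALBA L

------------------------------------------------------------------------
-- Algebras

infixl 9 _[_↦_]

_[_↦_] : ∀ {a n} {A : Set a} → Vector A n → Fin n → A → Vector A n
u [ i ↦ x ] = Vector.updateAt u i (const x)

record LEStructure {o} (L : Language o) (a ℓ₁ ℓ₂ : Level)
                   : Set (o ⊔ lsuc (a ⊔ ℓ₁ ⊔ ℓ₂)) where
  open Language L
  field
    boundedLattice : BoundedLattice a ℓ₁ ℓ₂

  open BoundedLattice boundedLattice public

  field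
    op : (h : Conn) → Vector Carrier (arity h) → Carrier

  eval    : {X : Set o} → (X → Carrier) → Term L X → Carrier
  evalVec : {X : Set o} → (X → Carrier) → ∀ {n} → Vec (Term L X) n → Vector Carrier n

  eval v (atom x)   = v x
  eval v ⊥ᵗ         = ⊥
  eval v ⊤ᵗ         = ⊤
  eval v (s ∧ᵗ t)   = eval v s ∧ eval v t
  eval v (s ∨ᵗ t)   = eval v s ∨ eval v t
  eval v (con h ts) = op h (evalVec v ts)

  evalVec v (t ∷ ts) zero    = eval v t
  evalVec v (t ∷ ts) (suc i) = evalVec v ts i

infix 4 _⊨_

_⊨_ : ∀ {o a ℓ₁ ℓ₂} {L : Language o} →
      LEStructure L a ℓ₁ ℓ₂ → Ineq L (Language.PROP L) → Set (o ⊔ a ⊔ ℓ₂)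
_⊨_ {L = L} A (φ ≼ ψ) =
  (v : Language.PROP L → Carrier) → eval v φ ≤ eval v ψ
  where open LEStructure A

module Coordinatewise {a ℓ₁ ℓ₂} (B : BoundedLattice a ℓ₁ ℓ₂) where
  open BoundedLattice B

  join^ meet^ : Coord → Carrier → Carrier → Carrier
  join^ 𝟙 x y = x ∨ y
  join^ ∂ x y = x ∧ y
  meet^ 𝟙 x y = x ∧ y
  meet^ ∂ x y = x ∨ y

  bottom^ top^ : Coord → Carrier
  bottom^ 𝟙 = ⊥
  bottom^ ∂ = ⊤
  top^ 𝟙 = ⊤
  top^ ∂ = ⊥

record LEAlgebra {o} (L : Language o) (a ℓ₁ ℓ₂ : Level)
                 : Set (o ⊔ lsuc (a ⊔ ℓ₁ ⊔ ℓ₂)) where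
  open Language L
  field
    structure : LEStructure L a ℓ₁ ℓ₂

  open LEStructure structure public

  open Coordinatewise boundedLattice public

  field
    op-cong : ∀ h {u v} → (∀ i → u i ≈ v i) → op h u ≈ op h v
    f-join  : ∀ f i u x y → let h = inj₁ f in
              op h (u [ i ↦ join^ (ε h i) x y ]) ≈ op h (u [ i ↦ x ]) ∨ op h (u [ i ↦ y ])
    f-empty : ∀ f i u → let h = inj₁ f in
              op h (u [ i ↦ bottom^ (ε h i) ]) ≈ ⊥
    g-meet  : ∀ g i u x y → let h = inj₂ g in
              op h (u [ i ↦ meet^ (ε h i) x y ]) ≈ op h (u [ i ↦ x ]) ∧ op h (u [ i ↦ y ])
    g-empty : ∀ g i u → let h = inj₂ g in
              op h (u [ i ↦ top^ (ε h i) ]) ≈ ⊤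

------------------------------------------------------------------------
-- Canonical extensions

record IsComplete {c e₁ e₂} (C : BoundedLattice c e₁ e₂) (i : Level)
                  : Set (lsuc i ⊔ c ⊔ e₂) where
  open BoundedLattice C
  field
    ⋁ ⋀        : {I : Set i} → (I → Carrier) → Carrier
    ⋁-upper    : ∀ {I} (x : I → Carrier) j → x j ≤ ⋁ x
    ⋁-least    : ∀ {I} (x : I → Carrier) {y} → (∀ j → x j ≤ y) → ⋁ x ≤ y
    ⋀-lower    : ∀ {I} (x : I → Carrier) j → ⋀ x ≤ x j
    ⋀-greatest : ∀ {I} (x : I → Carrier) {y} → (∀ j → y ≤ x j) → y ≤ ⋀ x

-- Subsets of L are predicates at the level s of L itself, and joins and meets
-- are asked for families at a level i large enough for those used below.  With
-- e₂ = lsuc s, i is lsuc s, and the closed sets of the Galois connection between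
-- filters and ideals of L form an instance without any appeal to resizing.

record CanonicalExtension {a ℓ₁ ℓ₂} (L : BoundedLattice a ℓ₁ ℓ₂) (c e₁ e₂ : Level)
                          : Set (lsuc (lsuc (a ⊔ ℓ₁ ⊔ ℓ₂) ⊔ c ⊔ e₁ ⊔ e₂)) where
  private module L = BoundedLattice L

  s : Level
  s = a ⊔ ℓ₁ ⊔ ℓ₂

  i : Level
  i = lsuc s ⊔ e₂

  field
    completion : BoundedLattice c e₁ e₂
    isComplete : IsComplete completion i

  open BoundedLattice completion public
  open IsComplete isComplete public

  field
    ι           : L.Carrier → Carrier
    ι-cong      : ∀ {x y} → x L.≈ y → ι x ≈ ι y
    ι-injective : ∀ {x y} → ι x ≈ ι y → x L.≈ y
    ι-∧         : ∀ x y → ι (x L.∧ y) ≈ ι x ∧ ι y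
    ι-∨         : ∀ x y → ι (x L.∨ y) ≈ ι x ∨ ι y
    ι-⊤         : ι L.⊤ ≈ ⊤
    ι-⊥         : ι L.⊥ ≈ ⊥

  ⋀[_] : Pred L.Carrier s → Carrier
  ⋀[ S ] = ⋀ {I = Lift i (∃ S)} (λ x → ι (proj₁ (lower x)))

  ⋁[_] : Pred L.Carrier s → Carrier
  ⋁[ S ] = ⋁ {I = Lift i (∃ S)} (λ x → ι (proj₁ (lower x)))

  field
    dense-⋁⋀ : ∀ u → ∃₂ λ (I : Set i) (S : I → Pred L.Carrier s) → u ≈ ⋁ (λ j → ⋀[ S j ])
    dense-⋀⋁ : ∀ u → ∃₂ λ (I : Set i) (S : I → Pred L.Carrier s) → u ≈ ⋀ (λ j → ⋁[ S j ])
    compact  : ∀ (S T : Pred L.Carrier s) → ⋀[ S ] ≤ ⋁[ T ] →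
               ∃₂ λ xs ys → All S xs × All T ys ×
                 foldr L._∧_ L.⊤ xs L.≤ foldr L._∨_ L.⊥ ys

  _≤[_]_ : Carrier → Coord → Carrier → Set e₂
  x ≤[ 𝟙 ] y = x ≤ y
  x ≤[ ∂ ] y = y ≤ x

  -- The elements of K^τ and O^τ, indexed by the subsets of L that present them.

  K^ O^ : Coord → Pred L.Carrier s → Carrier
  K^ 𝟙 S = ⋀[ S ]
  K^ ∂ S = ⋁[ S ]
  O^ 𝟙 S = ⋁[ S ]
  O^ ∂ S = ⋀[ S ]

  σ-closed σ-extension π-open π-extension :
    ∀ {n} → OrderType n → (Vector L.Carrier n → L.Carrier) →
    Vector Carrier n → Carrier

  σ-closed {n} ε f k =
    ⋀ {I = Lift i (∃ λ (x : Vector L.Carrier n) → ∀ j → k j ≤[ ε j ] ι (x j))}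
      (λ w → ι (f (proj₁ (lower w))))

  σ-extension {n} ε f u =
    ⋁ {I = ∃ λ (S : Vector (Pred L.Carrier s) n) → ∀ j → K^ (ε j) (S j) ≤[ ε j ] u j}
      (λ w → σ-closed ε f (λ j → K^ (ε j) (proj₁ w j)))

  π-open {n} ε g o =
    ⋁ {I = Lift i (∃ λ (x : Vector L.Carrier n) → ∀ j → ι (x j) ≤[ ε j ] o j)}
      (λ w → ι (g (proj₁ (lower w))))

  π-extension {n} ε g v =
    ⋀ {I = ∃ λ (S : Vector (Pred L.Carrier s) n) → ∀ j → v j ≤[ ε j ] O^ (ε j) (S j)}
      (λ w → π-open ε g (λ j → O^ (ε j) (proj₁ w j)))

canonicalExtension : ∀ {o a ℓ₁ ℓ₂ c e₁ e₂} {L : Language o} (A : LEAlgebra L a ℓ₁ ℓ₂) →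
                     CanonicalExtension (LEAlgebra.boundedLattice A) c e₁ e₂ →
                     LEStructure L c e₁ e₂
canonicalExtension {L = L} A E = record { boundedLattice = completion ; op = opᵟ }
  where
  open Language L
  open CanonicalExtension E
  open LEAlgebra A using (op)

  opᵟ : (h : Conn) → Vector Carrier (arity h) → Carrier
  opᵟ h@(inj₁ _) = σ-extension (ε h) (op h)
  opᵟ h@(inj₂ _) = π-extension (ε h) (op h)

{-# OPTIONS --safe #-}

-- Read nominals as closed and co-nominals as open elements of the canonical
-- extension.  If A satisfies the inequality then the extension satisfies it
-- under the assignments of variables to elements of A, and each reduction step
-- preserves this; the final system is pure, so there the restriction on the
-- variables is void, and the steps are then reversed for arbitrary assignments.
-- Approximation and residuation are sound because the extension of an operation
-- has a residual in each coordinate.  The Ackermann rules, restricted to A, are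
-- sound by compactness: the left-hand (right-hand) sides in the system always
-- have closed (open) values.
--
-- A sign σ reverses orders (x ≤⟨ - ⟩ y is y ≤ x) and exchanges closed with open.
-- With the sign + for F and - for G, every operation h preserves joins from the
-- sign τ · ε i of its i-th coordinate to its own sign τ, so that the four cases
-- of the theory, and both sides of an inequality, are treated as one.

module Submission where

open import Defs
open import Level using (Level; _⊔_; Lift; lift; lower) renaming (suc to lsuc)
open import Data.Bool.Base using (if_then_else_)
open import Data.Empty using (⊥-elim)
open import Data.Fin.Base using (Fin; zero; suc)
import Data.Fin.Properties as Fin
open import Data.List.Base using (List; []; _∷_; _++_; foldr; map)
open import Data.List.Relation.Binary.BagAndSetEquality using (_∼[_]_; set)
open import Data.List.Relation.Unary.All as All using (All; []; _∷_)
open import Data.List.Relation.Unary.All.Properties using (++⁺; ++⁻; ++⁻ˡ; ++⁻ʳ; map⁺; map⁻; ¬Any⇒All¬)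
open import Data.List.Relation.Unary.Any using (Any)
open import Data.Nat.Base using (ℕ)
open import Data.Product.Base using (∃; ∃₂; _×_; _,_; proj₁; proj₂)
open import Data.Sign.Base using (Sign; +; -; opposite)
open import Data.Sign.Properties using (opposite-involutive; opposite-injective)
open import Data.Sum.Base using (_⊎_; inj₁; inj₂)
open import Data.Vec.Base as Vec using (Vec; []; _∷_; lookup; _[_]≔_)
open import Data.Vec.Functional as Vector using (Vector)
open import Data.Vec.Properties using (lookup∘update; lookup∘update′)
open import Data.Vec.Functional.Properties using (updateAt-updates; updateAt-minimal)
open import Function.Base using (_∘_)
open import Function.Bundles using (Equivalence)
open import Relation.Binary.Construct.Closure.ReflexiveTransitive as Star using (Star; _◅_)
open import Relation.Binary.Definitions using (DecidableEquality)
open import Relation.Binary.Lattice using (BoundedLattice)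
open import Relation.Binary.PropositionalEquality
  using (_≡_; _≢_; refl; sym; trans; cong; subst; subst₂)
open import Relation.Nullary using (yes; no; does; ¬_)
open import Relation.Unary using (Pred)

-- Signs

-- The residuals of the extended operations need not send elements of `A` to elements of `A`, only
-- to closed or only to open ones. After residuation the extremal value of a variable in an
-- Ackermann rule may therefore lie outside `A`, and compactness has to supply an element of `A` in
-- its place. This is so in the forward direction alone: backwards the Ackermann rules are mere
-- monotonicity, which is why variables may then take arbitrary values. Closed values for nominals
-- serve both passes: they are dense, which is all that approximation asks for, and they keep
-- left-hand sides closed. Instead of preservation of directed meets, a finitary interpolation
-- property is carried through all operations: if a value at closed arguments lies below an element
-- of `A`, the arguments can be enlarged to elements of `A` without losing the inequality.
-- Statements about closed and open elements become membership in filters and ideals generated by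
-- subsets, which also keeps universe levels at those of the subsets.

·-opposite : ∀ σ κ → opposite σ · κ ≡ opposite (σ · κ)
·-opposite σ 𝟙 = refl
·-opposite σ ∂ = refl

·-involutive : ∀ σ κ → σ · κ · κ ≡ σ
·-involutive σ 𝟙 = refl
·-involutive σ ∂ = opposite-involutive σ

-- Residuation turns `h` of polarity `τ` into a connective of sign `opposite (τ · ε i)`. Its `i`-th
-- argument is the former other side of the inequality, of sign `opposite τ`; the remaining
-- arguments keep the sign `τ · ε j` they had under `h`. This is where the clauses of `adjointType`
-- come from.
adjointType-at : ∀ {n} τ (ε : OrderType n) i →
                 opposite (τ · ε i) · adjointType ε i i ≡ opposite τ
adjointType-at τ ε i with i Fin.≟ i
... | yes _  = trans (·-opposite (τ · ε i) (ε i)) (cong opposite (·-involutive τ (ε i)))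
... | no i≢i = ⊥-elim (i≢i refl)

adjointType-off : ∀ {n} τ (ε : OrderType n) {i j} → j ≢ i →
                  opposite (τ · ε i) · adjointType ε i j ≡ τ · ε j
adjointType-off τ ε {i} {j} j≢i with j Fin.≟ i
... | yes j≡i = ⊥-elim (j≢i j≡i)
... | no _ with ε i
...   | 𝟙 = opposite-·^∂ (ε j)
  where
  opposite-·^∂ : ∀ κ → opposite τ · (κ ^∂) ≡ τ · κ
  opposite-·^∂ 𝟙 = opposite-involutive τ
  opposite-·^∂ ∂ = refl
...   | ∂ = cong (_· ε j) (opposite-involutive τ)

sign-cases : ∀ σ ρ → ρ ≡ σ ⊎ ρ ≡ opposite σ
sign-cases + + = inj₁ refl
sign-cases + - = inj₂ refl
sign-cases - + = inj₂ refl
sign-cases - - = inj₁ refl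

-- Coordinatewise updates

split-at : ∀ {n p} (P : Fin n → Set p) {i} → P i → (∀ j → j ≢ i → P j) → ∀ j → P j
split-at P {i} Pi P≢ j with j Fin.≟ i
... | yes refl = Pi
... | no j≢i   = P≢ j j≢i

module _ {a} {A : Set a} where

  update-elim : ∀ {n p} (P : Fin n → A → Set p) {u : Vector A n} {i x} →
                P i x → (∀ j → j ≢ i → P j (u j)) → ∀ j → P j ((u [ i ↦ x ]) j)
  update-elim P {u} {i} Px Pu j with j Fin.≟ i
  ... | yes refl = subst (P i) (sym (updateAt-updates i u)) Px
  ... | no j≢i   = subst (P j) (sym (updateAt-minimal j i u j≢i)) (Pu j j≢i)

  update-elim₂ : ∀ {b n p} {B : Set b} (P : Fin n → A → B → Set p)
                 {u : Vector A n} {w : Vector B n} {i x y} →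
                 P i x y → (∀ j → j ≢ i → P j (u j) (w j)) →
                 ∀ j → P j ((u [ i ↦ x ]) j) ((w [ i ↦ y ]) j)
  update-elim₂ P {u} {w} {i} Pxy Puw j with j Fin.≟ i
  ... | yes refl = subst₂ (P i) (sym (updateAt-updates i u)) (sym (updateAt-updates i w)) Pxy
  ... | no j≢i   = subst₂ (P j) (sym (updateAt-minimal j i u j≢i))
                     (sym (updateAt-minimal j i w j≢i)) (Puw j j≢i)

  -- Replaces the entries of `u` by those of `w` one at a time, from the head on. The hypothesis on
  -- pointwise equal tuples stands in for function extensionality, since the intermediate tuples
  -- match only pointwise.
  monotone-by-coordinates :
    ∀ {b r s n} {B : Set b} (_≲_ : B → B → Set r) (R : Fin n → A → A → Set s) →
    (∀ {x y z} → x ≲ y → y ≲ z → x ≲ z) →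
    (f : Vector A n → B) →
    (∀ {u w} → (∀ j → u j ≡ w j) → f u ≲ f w) →
    (∀ i u {x y} → R i x y → f (u [ i ↦ x ]) ≲ f (u [ i ↦ y ])) →
    ∀ {u w} → (∀ j → R j (u j) (w j)) → f u ≲ f w
  monotone-by-coordinates {n = ℕ.zero} _ _ _ _ resp _ _ = resp λ ()
  monotone-by-coordinates {n = ℕ.suc n} _≲_ R ≲-trans f resp step {u} {w} uRw =
    ≲-trans (resp λ { zero → refl ; (suc j) → refl })
      (≲-trans (step zero u (uRw zero))
        (≲-trans
          (resp {w = w zero Vector.∷ Vector.tail u} λ { zero → refl ; (suc j) → refl })
          (≲-trans
            (monotone-by-coordinates _≲_ (R ∘ suc) ≲-trans (λ z → f (w zero Vector.∷ z))
              (λ eq → resp λ { zero → refl ; (suc j) → eq j })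
              (λ i z xRy → ≲-trans
                (resp λ { zero → refl ; (suc j) → refl })
                (≲-trans (step (suc i) (w zero Vector.∷ z) xRy)
                  (resp λ { zero → refl ; (suc j) → refl })))
              (uRw ∘ suc))
            (resp λ { zero → refl ; (suc j) → refl }))))

-- Orders and bounds reversed by the sign -

module Signed {c ℓ₁ ℓ₂} (B : BoundedLattice c ℓ₁ ℓ₂) where
  private module B = BoundedLattice B
  open B using (Carrier; _≈_)

  infix 4 _≤⟨_⟩_

  -- A datatype and not a function on signs, so that the sign of an inequality stays visible to
  -- unification instead of being computed away.
  data Ordered (x y : Carrier) : Sign → Set ℓ₂ where
    pos : x B.≤ y → Ordered x y +
    neg : y B.≤ x → Ordered x y -

  _≤⟨_⟩_ : Carrier → Sign → Carrier → Set ℓ₂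
  x ≤⟨ σ ⟩ y = Ordered x y σ

  pos⁻¹ : ∀ {x y} → x ≤⟨ + ⟩ y → x B.≤ y
  pos⁻¹ (pos p) = p

  neg⁻¹ : ∀ {x y} → x ≤⟨ - ⟩ y → y B.≤ x
  neg⁻¹ (neg p) = p

  ≤-reflexive : ∀ {σ x y} → x ≈ y → x ≤⟨ σ ⟩ y
  ≤-reflexive { + } x≈y = pos (B.reflexive x≈y)
  ≤-reflexive { - } x≈y = neg (B.reflexive (B.Eq.sym x≈y))

  ≤-refl : ∀ {σ x} → x ≤⟨ σ ⟩ x
  ≤-refl = ≤-reflexive B.Eq.refl

  ≤-trans : ∀ {σ x y z} → x ≤⟨ σ ⟩ y → y ≤⟨ σ ⟩ z → x ≤⟨ σ ⟩ z
  ≤-trans (pos p) (pos q) = pos (B.trans p q)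
  ≤-trans (neg p) (neg q) = neg (B.trans q p)

  ≤-antisym : ∀ {σ x y} → x ≤⟨ σ ⟩ y → y ≤⟨ σ ⟩ x → x ≈ y
  ≤-antisym (pos p) (pos q) = B.antisym p q
  ≤-antisym (neg p) (neg q) = B.antisym q p

  flip : ∀ {σ x y} → x ≤⟨ σ ⟩ y → y ≤⟨ opposite σ ⟩ x
  flip (pos p) = neg p
  flip (neg p) = pos p

  unflip : ∀ {σ x y} → x ≤⟨ opposite σ ⟩ y → y ≤⟨ σ ⟩ x
  unflip { + } (neg p) = pos p
  unflip { - } (pos p) = neg p

  meet join : Sign → Carrier → Carrier → Carrier
  meet + = B._∧_
  meet - = B._∨_
  join σ = meet (opposite σ)

  top bot : Sign → Carrier
  top + = B.⊤
  top - = B.⊥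
  bot σ = top (opposite σ)

  meet-lowerˡ : ∀ {σ x y} → meet σ x y ≤⟨ σ ⟩ x
  meet-lowerˡ { + } = pos (B.x∧y≤x _ _)
  meet-lowerˡ { - } = neg (B.x≤x∨y _ _)

  meet-lowerʳ : ∀ {σ x y} → meet σ x y ≤⟨ σ ⟩ y
  meet-lowerʳ { + } = pos (B.x∧y≤y _ _)
  meet-lowerʳ { - } = neg (B.y≤x∨y _ _)

  meet-greatest : ∀ {σ x y z} → x ≤⟨ σ ⟩ y → x ≤⟨ σ ⟩ z → x ≤⟨ σ ⟩ meet σ y z
  meet-greatest (pos p) (pos q) = pos (B.∧-greatest p q)
  meet-greatest (neg p) (neg q) = neg (B.∨-least p q)

  join-upperˡ : ∀ {σ x y} → x ≤⟨ σ ⟩ join σ x y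
  join-upperˡ = unflip meet-lowerˡ

  join-upperʳ : ∀ {σ x y} → y ≤⟨ σ ⟩ join σ x y
  join-upperʳ = unflip meet-lowerʳ

  join-least : ∀ {σ x y z} → x ≤⟨ σ ⟩ z → y ≤⟨ σ ⟩ z → join σ x y ≤⟨ σ ⟩ z
  join-least p q = unflip (meet-greatest (flip p) (flip q))

  meet-monotone : ∀ {σ x x′ y y′} → x ≤⟨ σ ⟩ x′ → y ≤⟨ σ ⟩ y′ → meet σ x y ≤⟨ σ ⟩ meet σ x′ y′
  meet-monotone p q = meet-greatest (≤-trans meet-lowerˡ p) (≤-trans meet-lowerʳ q)

  join-monotone : ∀ {σ x x′ y y′} → x ≤⟨ σ ⟩ x′ → y ≤⟨ σ ⟩ y′ → join σ x y ≤⟨ σ ⟩ join σ x′ y′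
  join-monotone p q = join-least (≤-trans p join-upperˡ) (≤-trans q join-upperʳ)

  ≤-top : ∀ {σ x} → x ≤⟨ σ ⟩ top σ
  ≤-top { + } = pos (B.maximum _)
  ≤-top { - } = neg (B.minimum _)

  bot-≤ : ∀ {σ x} → bot σ ≤⟨ σ ⟩ x
  bot-≤ = unflip ≤-top

  MonotoneAt : Sign → ∀ {n} → OrderType n → (Vector Carrier n → Carrier) → Set (c ⊔ ℓ₂)
  MonotoneAt σ ε f = ∀ {u w} → (∀ j → u j ≤⟨ σ · ε j ⟩ w j) → f u ≤⟨ σ ⟩ f w

  Monotone : ∀ {n} → OrderType n → (Vector Carrier n → Carrier) → Set (c ⊔ ℓ₂)
  Monotone ε f = ∀ {σ} → MonotoneAt σ ε f

  -- Reading the inequality from right to left reverses the sign of the value and of every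
  -- coordinate together, so one sign gives both.
  monotone : ∀ τ {n} {ε : OrderType n} {f} → MonotoneAt τ ε f → Monotone ε f
  monotone + m { + } p = m p
  monotone - m { - } p = m p
  monotone - {ε = ε} m { + } p =
    unflip (m λ j → subst (Ordered _ _) (sym (·-opposite + (ε j))) (flip (p j)))
  monotone + {ε = ε} m { - } p =
    unflip (m λ j → subst (Ordered _ _) (sym (·-opposite - (ε j))) (flip (p j)))

  -- Only the inequality that monotonicity does not give.
  JoinsAt : Sign → ∀ {n} → OrderType n → (Vector Carrier n → Carrier) → Set (c ⊔ ℓ₂)
  JoinsAt τ ε f = ∀ i u {x y} →
    f (u [ i ↦ join (τ · ε i) x y ]) ≤⟨ τ ⟩ join τ (f (u [ i ↦ x ])) (f (u [ i ↦ y ]))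

-- Canonical extensions

module Canonical {a ℓ₁ ℓ₂ c e₁ e₂} {B : BoundedLattice a ℓ₁ ℓ₂}
                 (E : CanonicalExtension B c e₁ e₂) where
  private
    module B = BoundedLattice B
    module E = CanonicalExtension E
  module 𝔸 = Signed B
  open Signed E.completion public
  open E using (Carrier; _≈_; ι; s; i)

  ι-mono : ∀ {σ x y} → x 𝔸.≤⟨ σ ⟩ y → ι x ≤⟨ σ ⟩ ι y
  ι-mono (𝔸.pos x≤y) = pos (ι-mono⁺ x≤y)
    where
    ι-mono⁺ : ∀ {x y} → x B.≤ y → ι x E.≤ ι y
    ι-mono⁺ {x} {y} x≤y = E.trans
      (E.reflexive (E.Eq.trans (E.ι-cong (B.antisym (B.∧-greatest B.refl x≤y) (B.x∧y≤x x y)))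
                               (E.ι-∧ x y)))
      (E.x∧y≤y _ _)
  ι-mono (𝔸.neg y≤x) = flip (ι-mono (𝔸.pos y≤x))

  ι-meet : ∀ {σ x y} → meet σ (ι x) (ι y) ≤⟨ σ ⟩ ι (𝔸.meet σ x y)
  ι-meet { + } = ≤-reflexive (E.Eq.sym (E.ι-∧ _ _))
  ι-meet { - } = ≤-reflexive (E.Eq.sym (E.ι-∨ _ _))

  Join : Sign → {I : Set i} → (I → Carrier) → Carrier
  Join + = E.⋁
  Join - = E.⋀

  Join-upper : ∀ {σ} {I : Set i} (x : I → Carrier) j → x j ≤⟨ σ ⟩ Join σ x
  Join-upper { + } x j = pos (E.⋁-upper x j)
  Join-upper { - } x j = neg (E.⋀-lower x j)

  Join-least : ∀ {σ} {I : Set i} (x : I → Carrier) {y} →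
               (∀ j → x j ≤⟨ σ ⟩ y) → Join σ x ≤⟨ σ ⟩ y
  Join-least { + } x x≤y = pos (E.⋁-least x λ j → pos⁻¹ (x≤y j))
  Join-least { - } x x≤y = neg (E.⋀-greatest x λ j → neg⁻¹ (x≤y j))

  -- The closed (for the sign +) and the open (for -) elements.

  K : Sign → Pred B.Carrier s → Carrier
  K + S = E.⋀[ S ]
  K - S = E.⋁[ S ]

  K-lower : ∀ {σ} S {x} → S x → K σ S ≤⟨ σ ⟩ ι x
  K-lower { + } S {x} Sx = pos (E.⋀-lower _ (lift (x , Sx)))
  K-lower { - } S {x} Sx = neg (E.⋁-upper _ (lift (x , Sx)))

  K-greatest : ∀ {σ} S {u} → (∀ {x} → S x → u ≤⟨ σ ⟩ ι x) → u ≤⟨ σ ⟩ K σ S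
  K-greatest { + } S u≤S = pos (E.⋀-greatest _ λ x → pos⁻¹ (u≤S (proj₂ (lower x))))
  K-greatest { - } S u≤S = neg (E.⋁-least _ λ x → neg⁻¹ (u≤S (proj₂ (lower x))))

  ≤-dense : ∀ {σ u w} → (∀ S → K σ S ≤⟨ σ ⟩ u → K σ S ≤⟨ σ ⟩ w) → u ≤⟨ σ ⟩ w
  ≤-dense { + } {u} S≤w with I , S , u≈ ← E.dense-⋁⋀ u =
    ≤-trans (≤-reflexive u≈)
      (Join-least _ λ j → S≤w (S j) (≤-trans (Join-upper _ j) (≤-reflexive (E.Eq.sym u≈))))
  ≤-dense { - } {u} S≤w with I , S , u≈ ← E.dense-⋀⋁ u =
    ≤-trans (≤-reflexive u≈)
      (Join-least _ λ j → S≤w (S j) (≤-trans (Join-upper _ j) (≤-reflexive (E.Eq.sym u≈))))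

  ≤-codense : ∀ {σ u w} →
              (∀ T → w ≤⟨ σ ⟩ K (opposite σ) T → u ≤⟨ σ ⟩ K (opposite σ) T) → u ≤⟨ σ ⟩ w
  ≤-codense u≤T = unflip (≤-dense λ T T≤w → flip (u≤T T (unflip T≤w)))

  -- The filter (for +) or ideal (for -) generated by S; membership of x in it
  -- is K σ S ≤⟨ σ ⟩ ι x, brought down to the level of the subsets of B.

  Gen : Sign → Pred B.Carrier s → Pred B.Carrier s
  Gen σ S x = ∃ λ xs → All S xs × foldr (𝔸.meet σ) (𝔸.top σ) xs 𝔸.≤⟨ σ ⟩ x

  Gen-top : ∀ {σ S} → Gen σ S (𝔸.top σ)
  Gen-top = [] , [] , 𝔸.≤-refl

  Gen-upward : ∀ {σ S x y} → x 𝔸.≤⟨ σ ⟩ y → Gen σ S x → Gen σ S y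
  Gen-upward x≤y (xs , Sxs , ≤x) = xs , Sxs , 𝔸.≤-trans ≤x x≤y

  Gen-meet : ∀ {σ S x y} → Gen σ S x → Gen σ S y → Gen σ S (𝔸.meet σ x y)
  Gen-meet {σ} (xs , Sxs , ≤x) (ys , Sys , ≤y) =
    xs ++ ys , ++⁺ Sxs Sys ,
    𝔸.meet-greatest (𝔸.≤-trans (lowerˡ xs) ≤x) (𝔸.≤-trans (lowerʳ xs) ≤y)
    where
    ⋀ᶠ : List B.Carrier → B.Carrier
    ⋀ᶠ = foldr (𝔸.meet σ) (𝔸.top σ)

    lowerˡ : ∀ xs → ⋀ᶠ (xs ++ ys) 𝔸.≤⟨ σ ⟩ ⋀ᶠ xs
    lowerˡ []       = 𝔸.≤-top
    lowerˡ (x ∷ xs) =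
      𝔸.meet-greatest 𝔸.meet-lowerˡ (𝔸.≤-trans 𝔸.meet-lowerʳ (lowerˡ xs))

    lowerʳ : ∀ xs → ⋀ᶠ (xs ++ ys) 𝔸.≤⟨ σ ⟩ ⋀ᶠ ys
    lowerʳ []       = 𝔸.≤-refl
    lowerʳ (x ∷ xs) = 𝔸.≤-trans 𝔸.meet-lowerʳ (lowerʳ xs)

  Gen⇒≤ : ∀ {σ S x} → Gen σ S x → K σ S ≤⟨ σ ⟩ ι x
  Gen⇒≤ {σ} {S} (xs , Sxs , ≤x) = ≤-trans (K≤⋀ᶠ Sxs) (ι-mono ≤x)
    where
    ι-top : ∀ σ → top σ ≤⟨ σ ⟩ ι (𝔸.top σ)
    ι-top + = ≤-reflexive (E.Eq.sym E.ι-⊤)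
    ι-top - = ≤-reflexive (E.Eq.sym E.ι-⊥)

    K≤⋀ᶠ : ∀ {xs} → All S xs → K σ S ≤⟨ σ ⟩ ι (foldr (𝔸.meet σ) (𝔸.top σ) xs)
    K≤⋀ᶠ []         = ≤-trans ≤-top (ι-top σ)
    K≤⋀ᶠ (Sx ∷ Sxs) = ≤-trans (meet-greatest (K-lower S Sx) (K≤⋀ᶠ Sxs)) ι-meet

  compact : ∀ {σ S T} → K σ S ≤⟨ σ ⟩ K (opposite σ) T → ∃ λ x → Gen σ S x × Gen (opposite σ) T x
  compact { + } {S} {T} (pos S≤T) with xs , ys , Sxs , Tys , xs≤ys ← E.compact S T S≤T =
    _ , (xs , Sxs , 𝔸.≤-refl) , (ys , Tys , 𝔸.neg xs≤ys)
  compact { - } {S} {T} (neg T≤S) with ys , xs , Tys , Sxs , ys≤xs ← E.compact T S T≤S =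
    _ , (xs , Sxs , 𝔸.≤-refl) , (ys , Tys , 𝔸.pos ys≤xs)

  -- The singleton of `x`: it generates the principal filter and the principal ideal, and so
  -- presents `ι x` both as a closed and as an open element.
  Up : B.Carrier → Pred B.Carrier s
  Up x y = Lift s (x ≡ y)

  K-Up : ∀ σ x → K σ (Up x) ≈ ι x
  K-Up σ x = ≤-antisym {σ} (K-lower _ (lift refl)) (K-greatest _ λ { (lift refl) → ≤-refl })

  Up-meets : ∀ {σ x xs} → All (Up x) xs → x 𝔸.≤⟨ σ ⟩ foldr (𝔸.meet σ) (𝔸.top σ) xs
  Up-meets []                = 𝔸.≤-top
  Up-meets (lift refl ∷ all) = 𝔸.meet-greatest 𝔸.≤-refl (Up-meets all)

  Gen-Up⇒≤ : ∀ {σ x y} → Gen σ (Up x) y → x 𝔸.≤⟨ σ ⟩ y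
  Gen-Up⇒≤ (xs , all , ≤y) = 𝔸.≤-trans (Up-meets all) ≤y

  -- Compactness against the singleton `Up x`. Together with `Gen⇒≤` this trades an inequality in
  -- the completion for a finite statement in the lattice.
  ≤⇒Gen : ∀ {σ S x} → K σ S ≤⟨ σ ⟩ ι x → Gen σ S x
  ≤⇒Gen {σ} {S} {x} S≤x
    with y , Sy , y∈ ← compact {σ} {T = Up x}
      (≤-trans S≤x (≤-reflexive (E.Eq.sym (K-Up (opposite σ) x)))) =
    Gen-upward (𝔸.unflip (Gen-Up⇒≤ y∈)) Sy

  -- Directed sets, and lattice operations on closed and open elements

  Directed : Sign → Pred B.Carrier s → Set s
  Directed σ S = ∃ S ×
    (∀ {x y} → S x → S y → ∃ λ z → S z × z 𝔸.≤⟨ σ ⟩ x × z 𝔸.≤⟨ σ ⟩ y)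

  Directed-meets : ∀ {σ S} → Directed σ S → ∀ {xs} → All S xs →
                   ∃ λ y → S y × y 𝔸.≤⟨ σ ⟩ foldr (𝔸.meet σ) (𝔸.top σ) xs
  Directed-meets ((y , Sy) , _) [] = y , Sy , 𝔸.≤-top
  Directed-meets dir@(_ , directed) (Sx ∷ Sxs)
    with y , Sy , y≤ ← Directed-meets dir Sxs
    with z , Sz , z≤x , z≤y ← directed Sx Sy =
    z , Sz , 𝔸.meet-greatest z≤x (𝔸.≤-trans z≤y y≤)

  -- In a directed set one member lies below any finite meet of members, so compactness yields a
  -- single witness in the set itself.
  Gen-directed : ∀ {σ S x} → Directed σ S → Gen σ S x → ∃ λ y → S y × y 𝔸.≤⟨ σ ⟩ x
  Gen-directed dir (xs , Sxs , ≤x) with y , Sy , y≤ ← Directed-meets dir Sxs =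
    y , Sy , 𝔸.≤-trans y≤ ≤x

  Closed : Sign → Carrier → Set (lsuc s ⊔ e₁)
  Closed σ u = ∃ λ S → u ≈ K σ S

  Closed-≈ : ∀ {σ u w} → u ≈ w → Closed σ w → Closed σ u
  Closed-≈ u≈w (S , w≈) = S , E.Eq.trans u≈w w≈

  Closed-ι : ∀ {σ} x → Closed σ (ι x)
  Closed-ι {σ} x = Up x , E.Eq.sym (K-Up σ x)

  interpolate : ∀ {σ u w} → Closed σ u → Closed (opposite σ) w → u ≤⟨ σ ⟩ w →
                ∃ λ x → u ≤⟨ σ ⟩ ι x × ι x ≤⟨ σ ⟩ w
  interpolate (S , u≈) (T , w≈) u≤w
    with x , Sx , Tx ← compact (≤-trans (≤-reflexive (E.Eq.sym u≈)) (≤-trans u≤w (≤-reflexive w≈))) =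
    x , ≤-trans (≤-reflexive u≈) (Gen⇒≤ Sx) ,
    ≤-trans (unflip (Gen⇒≤ Tx)) (≤-reflexive (E.Eq.sym w≈))

  -- The meet of the separate witnesses works, as each condition persists below. This lets all
  -- arguments of a connective share one value of a variable.
  Gen-common : ∀ {θ S n p} (P : Fin n → B.Carrier → Set p) →
    (∀ i {x y} → y 𝔸.≤⟨ θ ⟩ x → P i x → P i y) →
    (∀ i → ∃ λ x → Gen θ S x × P i x) → ∃ λ x → Gen θ S x × (∀ i → P i x)
  Gen-common {n = ℕ.zero}  P shrink Px = _ , Gen-top , λ ()
  Gen-common {n = ℕ.suc n} P shrink Px
    with x , Sx , P₀x ← Px zero
       | y , Sy , P₊y ← Gen-common (P ∘ suc) (shrink ∘ suc) (Px ∘ suc) =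
    _ , Gen-meet Sx Sy ,
    λ { zero → shrink zero 𝔸.meet-lowerˡ P₀x ; (suc i) → shrink (suc i) 𝔸.meet-lowerʳ (P₊y i) }

  Gen-common-All : ∀ {θ S ℓ p} {I : Set ℓ} (P : I → B.Carrier → Set p) →
    (∀ {i x y} → y 𝔸.≤⟨ θ ⟩ x → P i x → P i y) →
    ∀ {is} → All (λ i → ∃ λ x → Gen θ S x × P i x) is →
    ∃ λ x → Gen θ S x × All (λ i → P i x) is
  Gen-common-All P shrink [] = _ , Gen-top , []
  Gen-common-All P shrink ((x , Sx , Px) ∷ Pxs)
    with y , Sy , Pys ← Gen-common-All P shrink Pxs =
    _ , Gen-meet Sx Sy , shrink 𝔸.meet-lowerˡ Px ∷ All.map (shrink 𝔸.meet-lowerʳ) Pys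

  -- The pairs are drawn from the generated filters and not from `S` and `T`: the filters contain
  -- the top, a neutral partner in a meet, and are closed under finite meets.
  Pairs : (B.Carrier → B.Carrier → B.Carrier) → Sign →
          Pred B.Carrier s → Pred B.Carrier s → Pred B.Carrier s
  Pairs _∙_ σ S T z = ∃₂ λ x y → Gen σ S x × Gen σ T y × x ∙ y ≡ z

  K-Pairs-meet≤ : ∀ {σ} S T → K σ (Pairs (𝔸.meet σ) σ S T) ≤⟨ σ ⟩ meet σ (K σ S) (K σ T)
  K-Pairs-meet≤ S T = meet-greatest
    (K-greatest S λ Sx → ≤-trans
      (K-lower _ (_ , _ , ≤⇒Gen (K-lower S Sx) , Gen-top , refl)) (ι-mono 𝔸.meet-lowerˡ))
    (K-greatest T λ Ty → ≤-trans
      (K-lower _ (_ , _ , Gen-top , ≤⇒Gen (K-lower T Ty) , refl)) (ι-mono 𝔸.meet-lowerʳ))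

  Closed-meet : ∀ {σ u w} → Closed σ u → Closed σ w → Closed σ (meet σ u w)
  Closed-meet {σ} (S , u≈) (T , w≈) = Pairs (𝔸.meet σ) σ S T , ≤-antisym {σ}
    (K-greatest _ λ { (x , y , Sx , Ty , refl) → ≤-trans
      (meet-monotone (≤-trans (≤-reflexive u≈) (Gen⇒≤ Sx)) (≤-trans (≤-reflexive w≈) (Gen⇒≤ Ty)))
      ι-meet })
    (≤-trans (K-Pairs-meet≤ S T)
      (meet-monotone (≤-reflexive (E.Eq.sym u≈)) (≤-reflexive (E.Eq.sym w≈))))

  -- Compactness replaces distributivity. Against an open bound `R` above both `u` and `w` it finds
  -- `x` and `y` in the two filters that lie in the ideal of `R`, so their join is already below the
  -- bound.
  Closed-join : ∀ {σ u w} → Closed σ u → Closed σ w → Closed σ (join σ u w)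
  Closed-join {σ} {u} {w} (S , u≈) (T , w≈) = Pairs (𝔸.join σ) σ S T , ≤-antisym {σ}
    (K-greatest _ λ { (x , y , Sx , Ty , refl) → join-least
      (≤-trans (≤-reflexive u≈) (≤-trans (Gen⇒≤ Sx) (ι-mono 𝔸.join-upperˡ)))
      (≤-trans (≤-reflexive w≈) (≤-trans (Gen⇒≤ Ty) (ι-mono 𝔸.join-upperʳ))) })
    (≤-codense λ R ≤R → below R
      (compact (≤-trans (≤-reflexive (E.Eq.sym u≈)) (≤-trans join-upperˡ ≤R)))
      (compact (≤-trans (≤-reflexive (E.Eq.sym w≈)) (≤-trans join-upperʳ ≤R))))
    where
    below : ∀ R → (∃ λ x → Gen σ S x × Gen (opposite σ) R x) →
                  (∃ λ y → Gen σ T y × Gen (opposite σ) R y) →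
            K σ (Pairs (𝔸.join σ) σ S T) ≤⟨ σ ⟩ K (opposite σ) R
    below R (x , Sx , Rx) (y , Ty , Ry) = ≤-trans
      (K-lower _ (x , y , Sx , Ty , refl))
      (unflip (Gen⇒≤ (Gen-meet Rx Ry)))

  Pairs-meet-directed : ∀ {σ} S T → Directed σ (Pairs (𝔸.meet σ) σ S T)
  Pairs-meet-directed S T =
    (_ , _ , _ , Gen-top , Gen-top , refl) ,
    λ { (x , y , Sx , Ty , refl) (x′ , y′ , Sx′ , Ty′ , refl) →
      _ , (_ , _ , Gen-meet Sx Sx′ , Gen-meet Ty Ty′ , refl) ,
      𝔸.meet-greatest (𝔸.≤-trans 𝔸.meet-lowerˡ 𝔸.meet-lowerˡ) (𝔸.≤-trans 𝔸.meet-lowerʳ 𝔸.meet-lowerˡ) ,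
      𝔸.meet-greatest (𝔸.≤-trans 𝔸.meet-lowerˡ 𝔸.meet-lowerʳ) (𝔸.≤-trans 𝔸.meet-lowerʳ 𝔸.meet-lowerʳ) }

  meet-interpolates : ∀ {σ u w z} → Closed σ u → Closed σ w → meet σ u w ≤⟨ σ ⟩ ι z →
    ∃₂ λ x y → u ≤⟨ σ ⟩ ι x × w ≤⟨ σ ⟩ ι y × meet σ (ι x) (ι y) ≤⟨ σ ⟩ ι z
  meet-interpolates {σ} (S , u≈) (T , w≈) uw≤z
    with _ , (x , y , Sx , Ty , refl) , xy≤z ← Gen-directed (Pairs-meet-directed S T)
      (≤⇒Gen (≤-trans (K-Pairs-meet≤ S T) (≤-trans
        (meet-monotone (≤-reflexive (E.Eq.sym u≈)) (≤-reflexive (E.Eq.sym w≈))) uw≤z))) =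
    x , y , ≤-trans (≤-reflexive u≈) (Gen⇒≤ Sx) , ≤-trans (≤-reflexive w≈) (Gen⇒≤ Ty) ,
    ≤-trans ι-meet (ι-mono xy≤z)

  -- Extended operations and their residuals

  record Stable (ρ : Sign) {n} (ε : OrderType n) (f : Vector Carrier n → Carrier)
         : Set (lsuc s ⊔ c ⊔ e₁ ⊔ e₂) where
    field
      closed : ∀ {u} → (∀ j → Closed (ρ · ε j) (u j)) → Closed ρ (f u)
      -- Plays the role of preservation of directed meets (Esakia's lemma): a bound by an element of
      -- the lattice is already respected at lattice elements beyond the given closed arguments.
      interpolates : ∀ {u x} → (∀ j → Closed (ρ · ε j) (u j)) → f u ≤⟨ ρ ⟩ ι x →
        ∃ λ (y : Vector B.Carrier n) →
          (∀ j → u j ≤⟨ ρ · ε j ⟩ ι (y j)) × f (ι ∘ y) ≤⟨ ρ ⟩ ι x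

  -- For `ζ = +`, the values of `f` beyond the closed tuple presented by `S`, whose meet defines
  -- `f^σ` there. Membership in `Gen` replaces an inequality in the completion, so that this is
  -- again a subset at the level `s`.
  Image : ∀ {n} → OrderType n → (Vector B.Carrier n → B.Carrier) →
          Sign → Vector (Pred B.Carrier s) n → Pred B.Carrier s
  Image ε f ζ S y = ∃ λ x → (∀ j → Gen (ζ · ε j) (S j) (x j)) × f x ≡ y

  -- f^σ (τ = +) and g^π (τ = -), up to the order of the completion.

  record Extends (τ : Sign) {n} (ε : OrderType n) (f : Vector B.Carrier n → B.Carrier)
                 (fᵉ : Vector Carrier n → Carrier) : Set (lsuc s ⊔ c ⊔ e₂) where
    field
      least : ∀ {u y} →
        (∀ S → (∀ j → K (τ · ε j) (S j) ≤⟨ τ · ε j ⟩ u j) → K τ (Image ε f τ S) ≤⟨ τ ⟩ y) →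
        fᵉ u ≤⟨ τ ⟩ y
      upper : ∀ {u} S → (∀ j → K (τ · ε j) (S j) ≤⟨ τ · ε j ⟩ u j) →
        K τ (Image ε f τ S) ≤⟨ τ ⟩ fᵉ u

  module Operator
    {n} (τ : Sign) (ε : OrderType n) (f : Vector B.Carrier n → B.Carrier)
    (f-mono : 𝔸.Monotone ε f) (f-join : 𝔸.JoinsAt τ ε f)
    (f-bot : ∀ i u → f (u [ i ↦ 𝔸.bot (τ · ε i) ]) 𝔸.≤⟨ τ ⟩ 𝔸.bot τ)
    (fᵉ : Vector Carrier n → Carrier) (f⊑fᵉ : Extends τ ε f fᵉ) where

    open Extends f⊑fᵉ

    private
      δ : Fin n → Sign
      δ j = τ · ε j

    fᵉ-monotone : Monotone ε fᵉ
    fᵉ-monotone = monotone τ {ε = ε} λ u≤w → least λ S S≤u → upper S λ j → ≤-trans (S≤u j) (u≤w j)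

    Image-directed : ∀ ζ S → Directed ζ (Image ε f ζ S)
    Image-directed ζ S =
      (_ , _ , (λ j → Gen-top) , refl) ,
      λ { (x , Sx , refl) (y , Sy , refl) →
          _ , (_ , (λ j → Gen-meet (Sx j) (Sy j)) , refl) ,
          f-mono (λ j → 𝔸.meet-lowerˡ) , f-mono (λ j → 𝔸.meet-lowerʳ) }

    K-Image : ∀ {ζ S x} → (∀ j → K (ζ · ε j) (S j) ≤⟨ ζ · ε j ⟩ ι (x j)) →
              K ζ (Image ε f ζ S) ≤⟨ ζ ⟩ ι (f x)
    K-Image S≤x = K-lower _ (_ , ≤⇒Gen ∘ S≤x , refl)

    fᵉ-ι : ∀ x → fᵉ (ι ∘ x) ≈ ι (f x)
    fᵉ-ι x = ≤-antisym {τ}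
      (least λ S S≤x → K-Image S≤x)
      (≤-trans
        (K-greatest _ λ { (y , y∈ , refl) → ι-mono (f-mono λ j → Gen-Up⇒≤ (y∈ j)) })
        (upper (Up ∘ x) λ j → ≤-reflexive (K-Up (δ j) (x j))))

    -- For `ζ = τ` this is the definition of the extension. For the opposite sign, compactness puts
    -- a lattice element between each coordinate of an approximating tuple `S′` and that of `u`, and
    -- the value of `f` there separates the two sides. Hence the original operations are stable at
    -- both signs.
    K-Image-least : ∀ {u} ζ S → (∀ j → u j ≈ K (ζ · ε j) (S j)) → K ζ (Image ε f ζ S) ≤⟨ ζ ⟩ fᵉ u
    K-Image-least {u} ζ S u≈S with sign-cases τ ζ
    ... | inj₁ refl = upper S λ j → ≤-reflexive (E.Eq.sym (u≈S j))
    ... | inj₂ refl = flip (least λ S′ S′≤u →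
      let between : ∀ j → ∃ λ x → Gen (δ j) (S′ j) x × Gen (opposite τ · ε j) (S j) x
          between j = subst (λ σ → u j ≈ K σ (S j) → ∃ λ x → Gen (δ j) (S′ j) x × Gen σ (S j) x)
            (sym (·-opposite τ (ε j)))
            (λ uj≈ → compact (≤-trans (S′≤u j) (≤-reflexive uj≈))) (u≈S j)
      in ≤-trans (K-lower _ (_ , proj₁ ∘ proj₂ ∘ between , refl))
                 (unflip (K-lower _ (_ , proj₂ ∘ proj₂ ∘ between , refl))))

    fᵉ-K : ∀ {u} ζ S → (∀ j → u j ≈ K (ζ · ε j) (S j)) → fᵉ u ≈ K ζ (Image ε f ζ S)
    fᵉ-K {u} ζ S u≈S = ≤-antisym {ζ}
      (K-greatest _ λ { (x , Sx , refl) → ≤-trans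
        (fᵉ-monotone λ j → ≤-trans (≤-reflexive (u≈S j)) (Gen⇒≤ (Sx j)))
        (≤-reflexive (fᵉ-ι x)) })
      (K-Image-least ζ S u≈S)

    fᵉ-stable : ∀ ρ → Stable ρ ε fᵉ
    fᵉ-stable ρ = record { closed = closed ; interpolates = interpolates }
      where
      closed : ∀ {u} → (∀ j → Closed (ρ · ε j) (u j)) → Closed ρ (fᵉ u)
      closed cl = _ , fᵉ-K ρ (proj₁ ∘ cl) (proj₂ ∘ cl)

      interpolates : ∀ {u x} → (∀ j → Closed (ρ · ε j) (u j)) → fᵉ u ≤⟨ ρ ⟩ ι x →
        ∃ λ (y : Vector B.Carrier n) →
          (∀ j → u j ≤⟨ ρ · ε j ⟩ ι (y j)) × fᵉ (ι ∘ y) ≤⟨ ρ ⟩ ι x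
      interpolates cl fu≤x
        with _ , (y , Sy , refl) , fy≤x ← Gen-directed (Image-directed ρ (proj₁ ∘ cl))
          (≤⇒Gen (≤-trans (K-Image-least ρ (proj₁ ∘ cl) (proj₂ ∘ cl)) fu≤x)) =
        y , (λ j → ≤-trans (≤-reflexive (proj₂ (cl j))) (Gen⇒≤ (Sy j))) ,
        ≤-trans (≤-reflexive (fᵉ-ι y)) (ι-mono fy≤x)

    module Residual (i : Fin n) where

      -- For closed coordinates j ≢ i and an open bound, the largest value of
      -- the i-th coordinate is open, generated by the following subset.

      Section : Vector (Pred B.Carrier s) n → Pred B.Carrier s → Pred B.Carrier s
      Section S T b = ∃ λ x →
        (∀ j → j ≢ i → Gen (δ j) (S j) (x j)) × Gen (opposite τ) T (f (x [ i ↦ b ]))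

      f-update-mono : ∀ {x y b b′} → (∀ j → j ≢ i → x j 𝔸.≤⟨ δ j ⟩ y j) → b 𝔸.≤⟨ δ i ⟩ b′ →
                      f (x [ i ↦ b ]) 𝔸.≤⟨ τ ⟩ f (y [ i ↦ b′ ])
      f-update-mono x≤y b≤b′ =
        f-mono (update-elim₂ (λ j x y → x 𝔸.≤⟨ δ j ⟩ y) b≤b′ x≤y)

      -- Join preservation enters here: if `f` respects the bound at `b` and at `b′`, it does so at
      -- their join once the parameters are shrunk to their meets. Preservation of the empty join
      -- makes the section inhabited.
      Section-directed : ∀ S T → Directed (opposite (δ i)) (Section S T)
      Section-directed S T =
        (𝔸.bot (δ i) , (𝔸.top ∘ δ) , (λ j _ → Gen-top) ,
          Gen-upward (𝔸.flip (f-bot i _)) Gen-top) ,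
        λ { {b} {b′} (x , Sx , Tb) (y , Sy , Tb′) →
          𝔸.join (δ i) b b′ ,
          ((λ j → 𝔸.meet (δ j) (x j) (y j)) , (λ j j≢i → Gen-meet (Sx j j≢i) (Sy j j≢i)) ,
            Gen-upward
              (𝔸.flip (𝔸.≤-trans (f-join i _)
                (𝔸.join-least
                  (𝔸.≤-trans (f-update-mono (λ j _ → 𝔸.meet-lowerˡ) 𝔸.≤-refl) 𝔸.join-upperˡ)
                  (𝔸.≤-trans (f-update-mono (λ j _ → 𝔸.meet-lowerʳ) 𝔸.≤-refl) 𝔸.join-upperʳ))))
              (Gen-meet Tb Tb′)) ,
          𝔸.meet-lowerˡ , 𝔸.meet-lowerʳ }

      -- Tested at a closed `S′` below `w i`: the hypothesis then puts a closed value of `f` below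
      -- an open bound, and the tuple returned by compactness consists of parameters and of an
      -- `i`-th entry that lies above `S′` and in the section.
      ≤Section : ∀ {S T w} → (∀ j → j ≢ i → K (δ j) (S j) ≤⟨ δ j ⟩ w j) →
                 fᵉ w ≤⟨ τ ⟩ K (opposite τ) T → w i ≤⟨ δ i ⟩ K (opposite (δ i)) (Section S T)
      ≤Section {S} {T} {w} S≤w fw≤T = ≤-dense λ S′ S′≤wi → bound S′
        (compact (≤-trans (upper (S [ i ↦ S′ ])
          (update-elim (λ j S → K (δ j) S ≤⟨ δ j ⟩ w j) S′≤wi S≤w)) fw≤T))
        where
        bound : ∀ S′ → (∃ λ z → Gen τ (Image ε f τ (S [ i ↦ S′ ])) z × Gen (opposite τ) T z) →
                K (δ i) S′ ≤⟨ δ i ⟩ K (opposite (δ i)) (Section S T)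
        bound S′ (z , z∈ , Tz)
          with _ , (x , Sx , refl) , fx≤z ← Gen-directed (Image-directed τ _) z∈ =
          ≤-trans
            (Gen⇒≤ (subst (λ S → Gen (δ i) S (x i)) (updateAt-updates i S) (Sx i)))
            (unflip (K-lower _ (x ,
              (λ j j≢i → subst (λ S → Gen (δ j) S (x j)) (updateAt-minimal j i S j≢i) (Sx j)) ,
              Gen-upward (𝔸.flip (𝔸.≤-trans
                (f-mono (update-elim (λ j y → y 𝔸.≤⟨ δ j ⟩ x j) 𝔸.≤-refl λ j _ → 𝔸.≤-refl))
                fx≤z)) Tz)))

      Section≤ : ∀ {S T w} → (∀ j → j ≢ i → w j ≤⟨ δ j ⟩ K (δ j) (S j)) →
                 w i ≤⟨ δ i ⟩ K (opposite (δ i)) (Section S T) → fᵉ w ≤⟨ τ ⟩ K (opposite τ) T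
      Section≤ {S} {T} {w} w≤S wi≤ = least λ S′ S′≤w → bound S′ S′≤w
        (compact (≤-trans (S′≤w i) wi≤))
        where
        bound : ∀ S′ → (∀ j → K (δ j) (S′ j) ≤⟨ δ j ⟩ w j) →
                (∃ λ b → Gen (δ i) (S′ i) b × Gen (opposite (δ i)) (Section S T) b) →
                K τ (Image ε f τ S′) ≤⟨ τ ⟩ K (opposite τ) T
        bound S′ S′≤w (b , S′b , b∈)
          with b′ , (x , Sx , Tb′) , b≤b′ ← Gen-directed (Section-directed S T) b∈ =
          ≤-trans
            (K-lower _ (x [ i ↦ b ] ,
              update-elim (λ j → Gen (δ j) (S′ j)) S′b
                (λ j j≢i → ≤⇒Gen (≤-trans (S′≤w j) (≤-trans (w≤S j j≢i) (Gen⇒≤ (Sx j j≢i))))) ,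
              refl))
            (≤-trans (ι-mono (f-update-mono (λ _ _ → 𝔸.≤-refl) (𝔸.unflip b≤b′)))
              (unflip (Gen⇒≤ Tb′)))

      -- The join of all admissible values of the `i`-th coordinate, with the bound taken from
      -- `u i`. It runs over closed elements, given by subsets, because a join over all elements of
      -- the completion could exceed the level at which joins exist; density makes up for the rest.
      residual : Vector Carrier n → Carrier
      residual u = Join (δ i)
        {I = ∃ λ S → fᵉ (u [ i ↦ K (δ i) S ]) ≤⟨ τ ⟩ u i} (λ S → K (δ i) (proj₁ S))

      residual-≥ : ∀ {u w} → (∀ j → j ≢ i → w j ≤⟨ δ j ⟩ u j) →
                   fᵉ u ≤⟨ τ ⟩ w i → u i ≤⟨ δ i ⟩ residual w
      residual-≥ w≤u fu≤wi = ≤-dense λ S S≤ui → Join-upper _ (S ,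
        ≤-trans (fᵉ-monotone (update-elim (λ j x → x ≤⟨ δ j ⟩ _) S≤ui w≤u)) fu≤wi)

      -- Density reduces the claim to closed parameters and an open bound `T`. There all admissible
      -- values lie below the section by `≤Section`, hence so does their join, and `Section≤`
      -- returns the inequality.
      residual-≤ : ∀ {u w} → (∀ j → j ≢ i → u j ≤⟨ δ j ⟩ w j) →
                   u i ≤⟨ δ i ⟩ residual w → fᵉ u ≤⟨ τ ⟩ w i
      residual-≤ {u} {w} u≤w ui≤ = ≤-codense λ T wi≤T → least λ S S≤u →
        ≤-trans (upper S λ j → ≤-refl)
          (Section≤ (λ j _ → ≤-refl)
            (≤-trans (S≤u i) (≤-trans ui≤ (Join-least _ λ { (S′ , fS′≤wi) →
              subst (_≤⟨ δ i ⟩ _) (updateAt-updates i w)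
                (≤Section
                  (λ j j≢i → subst (_ ≤⟨ δ j ⟩_) (sym (updateAt-minimal j i w j≢i))
                    (≤-trans (S≤u j) (u≤w j j≢i)))
                  (≤-trans fS′≤wi wi≤T)) }))))

      residual-≥-update : ∀ {u w x} → (∀ j → j ≢ i → w j ≤⟨ δ j ⟩ u j) →
                          fᵉ (u [ i ↦ x ]) ≤⟨ τ ⟩ w i → x ≤⟨ δ i ⟩ residual w
      residual-≥-update {u} {w} w≤u fu≤wi = subst (_≤⟨ δ i ⟩ _) (updateAt-updates i u)
        (residual-≥ (λ j j≢i → subst (_ ≤⟨ δ j ⟩_) (sym (updateAt-minimal j i u j≢i)) (w≤u j j≢i))
          fu≤wi)

      residual-≤-update : ∀ {w x} → x ≤⟨ δ i ⟩ residual w → fᵉ (w [ i ↦ x ]) ≤⟨ τ ⟩ w i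
      residual-≤-update {w} x≤ = residual-≤
        (λ j j≢i → subst (_≤⟨ δ j ⟩ _) (sym (updateAt-minimal j i w j≢i)) ≤-refl)
        (subst (_≤⟨ δ i ⟩ _) (sym (updateAt-updates i w)) x≤)

      adjoint⇒ : ∀ {u x y} → fᵉ (u [ i ↦ x ]) ≤⟨ τ ⟩ y → x ≤⟨ δ i ⟩ residual (u [ i ↦ y ])
      adjoint⇒ {u} fx≤y = residual-≥-update
        (λ j j≢i → ≤-reflexive (E.Eq.reflexive (updateAt-minimal j i u j≢i)))
        (≤-trans fx≤y (≤-reflexive (E.Eq.reflexive (sym (updateAt-updates i u)))))

      adjoint⇐ : ∀ {u x y} → x ≤⟨ δ i ⟩ residual (u [ i ↦ y ]) → fᵉ (u [ i ↦ x ]) ≤⟨ τ ⟩ y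
      adjoint⇐ {u} {x} {y} x≤ = ≤-trans
        (≤-trans
          (fᵉ-monotone (update-elim₂ (λ j → _≤⟨ δ j ⟩_) ≤-refl
            λ j j≢i → ≤-reflexive (E.Eq.reflexive (sym (updateAt-minimal j i u j≢i)))))
          (residual-≤-update x≤))
        (≤-reflexive (E.Eq.reflexive (updateAt-updates i u)))

      -- A left adjoint preserves joins.
      fᵉ-joins : ∀ u {x y} → fᵉ (u [ i ↦ join (δ i) x y ]) ≤⟨ τ ⟩
                             join τ (fᵉ (u [ i ↦ x ])) (fᵉ (u [ i ↦ y ]))
      fᵉ-joins u = adjoint⇐ (join-least (adjoint⇒ join-upperˡ) (adjoint⇒ join-upperʳ))

      residual-monotone : Monotone (adjointType ε i) residual
      residual-monotone = monotone (opposite (δ i)) {ε = adjointType ε i} λ {u} {w} u≤w →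
        flip (residual-≥-update
          (λ j j≢i → subst (Ordered (u j) (w j)) (adjointType-off τ ε j≢i) (u≤w j))
          (≤-trans (residual-≤-update ≤-refl)
            (unflip (subst (Ordered (u i) (w i)) (adjointType-at τ ε i) (u≤w i)))))

      -- The unit of the adjunction, at lattice elements.
      residual-ι : ∀ y b → ι b ≤⟨ δ i ⟩ residual (ι ∘ (y [ i ↦ f (y [ i ↦ b ]) ]))
      residual-ι y b = residual-≥-update {u = ι ∘ y}
        (λ j j≢i → ≤-reflexive (E.Eq.reflexive (cong ι (updateAt-minimal j i y j≢i))))
        (≤-trans (fᵉ-monotone update-ι)
          (≤-reflexive (E.Eq.trans (fᵉ-ι (y [ i ↦ b ]))
            (E.Eq.reflexive (cong ι (sym (updateAt-updates i y)))))))
        where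
        update-ι : ∀ j → ((ι ∘ y) [ i ↦ ι b ]) j ≤⟨ δ j ⟩ ι ((y [ i ↦ b ]) j)
        update-ι = update-elim₂ (λ j z x → z ≤⟨ δ j ⟩ ι x) ≤-refl (λ j _ → ≤-refl)

      -- At such arguments the residual is presented by the directed set `Section`, each member of
      -- which comes with parameters from the lattice.
      residual-stable : Stable (opposite (δ i)) (adjointType ε i) residual
      residual-stable = record { closed = closed ; interpolates = λ cl → interpolates cl }
        where
        module _ {u : Vector Carrier n}
                 (cl : ∀ j → Closed (opposite (δ i) · adjointType ε i j) (u j)) where
          S : Vector (Pred B.Carrier s) n
          S = proj₁ ∘ cl

          u-off : ∀ j → j ≢ i → u j ≈ K (δ j) (S j)
          u-off j j≢i = subst (λ σ → u j ≈ K σ (S j)) (adjointType-off τ ε j≢i) (proj₂ (cl j))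

          u-at : u i ≈ K (opposite τ) (S i)
          u-at = subst (λ σ → u i ≈ K σ (S i)) (adjointType-at τ ε i) (proj₂ (cl i))

          residual≤ : residual u ≤⟨ δ i ⟩ K (opposite (δ i)) (Section S (S i))
          residual≤ = subst (_≤⟨ δ i ⟩ K (opposite (δ i)) (Section S (S i))) (updateAt-updates i u)
            (≤Section {S = S}
              (λ j j≢i → subst (K (δ j) (S j) ≤⟨ δ j ⟩_) (sym (updateAt-minimal j i u j≢i))
                (≤-reflexive (E.Eq.sym (u-off j j≢i))))
              (≤-trans (residual-≤-update ≤-refl) (≤-reflexive u-at)))

          ≤residual : K (opposite (δ i)) (Section S (S i)) ≤⟨ δ i ⟩ residual u
          ≤residual = residual-≥-update (λ j _ → ≤-refl)
            (≤-trans
              (Section≤ {S = S}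
                (λ j j≢i → subst (_≤⟨ δ j ⟩ K (δ j) (S j)) (sym (updateAt-minimal j i u j≢i))
                  (≤-reflexive (u-off j j≢i)))
                (≤-reflexive (E.Eq.reflexive (updateAt-updates i u))))
              (≤-reflexive (E.Eq.sym u-at)))

          closed : Closed (opposite (δ i)) (residual u)
          closed = _ , ≤-antisym residual≤ ≤residual

          interpolant : ∀ {x} →
            (∃ λ b → Section S (S i) b × b 𝔸.≤⟨ opposite (δ i) ⟩ x) →
            ∃ λ (y : Vector B.Carrier n) →
              (∀ j → u j ≤⟨ opposite (δ i) · adjointType ε i j ⟩ ι (y j)) ×
              residual (ι ∘ y) ≤⟨ opposite (δ i) ⟩ ι x
          interpolant (b , (y , Sy , Tb) , b≤x) =
            -- The `i`-th entry is the least bound under which `b` is still an admissible value for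
            -- the parameters `y`.
            y [ i ↦ f (y [ i ↦ b ]) ] ,
            update-elim (λ j z → u j ≤⟨ opposite (δ i) · adjointType ε i j ⟩ ι z)
              (subst (Ordered (u i) (ι (f (y [ i ↦ b ])))) (sym (adjointType-at τ ε i))
                (≤-trans (≤-reflexive u-at) (Gen⇒≤ Tb)))
              (λ j j≢i → subst (Ordered (u j) (ι (y j))) (sym (adjointType-off τ ε j≢i))
                (≤-trans (≤-reflexive (u-off j j≢i)) (Gen⇒≤ (Sy j j≢i)))) ,
            flip (≤-trans (ι-mono (𝔸.unflip b≤x)) (residual-ι y b))

          interpolates : ∀ {x} → residual u ≤⟨ opposite (δ i) ⟩ ι x →
            ∃ λ (y : Vector B.Carrier n) →
              (∀ j → u j ≤⟨ opposite (δ i) · adjointType ε i j ⟩ ι (y j)) ×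
              residual (ι ∘ y) ≤⟨ opposite (δ i) ⟩ ι x
          interpolates ru≤x = interpolant (Gen-directed (Section-directed S (S i))
            (≤⇒Gen (≤-trans (flip residual≤) ru≤x)))

-- Terms

module _ {o} {L : Language o} {X : Set o} where
  open Language L

  Occ-opposite : ∀ {x : X} {σ ρ t} → Occ {L = L} x σ ρ t → Occ {L = L} x (opposite σ) (opposite ρ) t
  Occ-opposite here          = here
  Occ-opposite (∧ˡ o)        = ∧ˡ (Occ-opposite o)
  Occ-opposite (∧ʳ o)        = ∧ʳ (Occ-opposite o)
  Occ-opposite (∨ˡ o)        = ∨ˡ (Occ-opposite o)
  Occ-opposite (∨ʳ o)        = ∨ʳ (Occ-opposite o)
  Occ-opposite {σ = σ} {ρ} (arg h {ts} i o) =
    arg h i (subst (λ τ → Occ _ (opposite σ) τ (lookup ts i)) (sym (·-opposite ρ (ε h i)))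
      (Occ-opposite o))

  -- Covers `PositiveIn` and `NegativeIn` with an arbitrary root sign, since right-hand sides are
  -- read from the root sign `-`.
  Uniform : Sign → Sign → X → Term L X → Set o
  Uniform θ ρ x t = ∀ {σ} → Occ x σ ρ t → σ ≡ θ

  Uniform-opposite : ∀ {θ ρ x t} → Uniform θ ρ x t → Uniform (opposite θ) (opposite ρ) x t
  Uniform-opposite {θ} {ρ} {x} {t} uniform {σ} o = opposite-injective
    (trans (uniform (subst (λ ρ → Occ x (opposite σ) ρ t) (opposite-involutive ρ) (Occ-opposite o)))
           (sym (opposite-involutive θ)))

  Fresh : X → Term L X → Set o
  Fresh x t = ∀ {σ ρ} → ¬ Occ x σ ρ t

  fresh : ∀ {x t} → ¬ (x OccursIn t) → Fresh x t
  fresh ∉t {ρ = + } o = ∉t (_ , o)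
  fresh ∉t {ρ = - } o = ∉t (_ , Occ-opposite o)

  Fresh-arg : ∀ {x h ts} → Fresh x (con h ts) → ∀ i → Fresh x (lookup ts i)
  Fresh-arg {h = h} {ts} x∉ i {σ} {ρ} o = x∉ {ρ = ρ · ε h i} (arg h i
    (subst (λ τ → Occ _ σ τ (lookup ts i)) (sym (·-involutive ρ (ε h i))) o))

module _ {o} {L : Language o} {X : Set o} (_≟_ : DecidableEquality X) where
  open Substitution {L = L} _≟_

  substitute-atom-elim : ∀ {p} (P : Term L X → Set p) {x y s} →
    (y ≡ x → P s) → (y ≢ x → P (atom y)) → P (substitute (atom y) x s)
  substitute-atom-elim P {x} {y} Ps Py with y ≟ x
  ... | yes y≡x = Ps y≡x
  ... | no y≢x  = Py y≢x

  lookup-substituteVec : ∀ {n} (ts : Vec (Term L X) n) x s i →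
                         lookup (substituteVec ts x s) i ≡ substitute (lookup ts i) x s
  lookup-substituteVec (t ∷ ts) x s zero    = refl
  lookup-substituteVec (t ∷ ts) x s (suc i) = lookup-substituteVec ts x s i

-- Assignments and the evaluation of terms

module Assignment {o c} {X : Set o} (_≟_ : DecidableEquality X) {A : Set c} where

  _[_:=_] : (X → A) → X → A → X → A
  (v [ x := u ]) y = if does (y ≟ x) then u else v y

  assign-elim : ∀ {p} (v : X → A) {x u y} (P : A → Set p) →
                (y ≡ x → P u) → (y ≢ x → P (v y)) → P ((v [ x := u ]) y)
  assign-elim v {x} {y = y} P Pu Pv with y ≟ x
  ... | yes y≡x = Pu y≡x
  ... | no y≢x  = Pv y≢x

  assign-at : ∀ (v : X → A) {x u} → (v [ x := u ]) x ≡ u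
  assign-at v {u = u} = assign-elim v (_≡ u) (λ _ → refl) (λ x≢x → ⊥-elim (x≢x refl))

  assign-off : ∀ (v : X → A) {x y u} → y ≢ x → (v [ x := u ]) y ≡ v y
  assign-off v {y = y} y≢x = assign-elim v (_≡ v y) (λ y≡x → ⊥-elim (y≢x y≡x)) (λ _ → refl)

polarity : ∀ {a b} {A : Set a} {B : Set b} → A ⊎ B → Sign
polarity (inj₁ _) = +
polarity (inj₂ _) = -

module Evaluation {o c ℓ₁ ℓ₂} {L : Language o} (M : LEStructure L c ℓ₁ ℓ₂)
  (op-monotone : ∀ h → Signed.Monotone (LEStructure.boundedLattice M)
                         (Language.ε L h) (LEStructure.op M h))
  {X : Set o} (_≟_ : DecidableEquality X) where

  open Language L
  private module M = LEStructure M
  open M using (Carrier; _≈_; op; eval; evalVec)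
  open Signed M.boundedLattice
  open Assignment _≟_ {A = Carrier}
  open Substitution {L = L} _≟_

  op-cong : ∀ h {u w} → (∀ j → u j ≈ w j) → op h u ≈ op h w
  op-cong h u≈w = ≤-antisym { + } (op-monotone h λ j → ≤-reflexive (u≈w j))
                                  (op-monotone h λ j → ≤-reflexive (M.Eq.sym (u≈w j)))

  ∧-monotone : ∀ σ {x x′ y y′} → x ≤⟨ σ ⟩ x′ → y ≤⟨ σ ⟩ y′ → x M.∧ y ≤⟨ σ ⟩ x′ M.∧ y′
  ∧-monotone + = meet-monotone
  ∧-monotone - = join-monotone

  ∨-monotone : ∀ σ {x x′ y y′} → x ≤⟨ σ ⟩ x′ → y ≤⟨ σ ⟩ y′ → x M.∨ y ≤⟨ σ ⟩ x′ M.∨ y′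
  ∨-monotone + = join-monotone
  ∨-monotone - = meet-monotone

  ∧-cong : ∀ {x x′ y y′} → x ≈ x′ → y ≈ y′ → x M.∧ y ≈ x′ M.∧ y′
  ∧-cong p q = ≤-antisym { + }
    (∧-monotone + (≤-reflexive p) (≤-reflexive q))
    (∧-monotone + (≤-reflexive (M.Eq.sym p)) (≤-reflexive (M.Eq.sym q)))

  ∨-cong : ∀ {x x′ y y′} → x ≈ x′ → y ≈ y′ → x M.∨ y ≈ x′ M.∨ y′
  ∨-cong p q = ≤-antisym { + }
    (∨-monotone + (≤-reflexive p) (≤-reflexive q))
    (∨-monotone + (≤-reflexive (M.Eq.sym p)) (≤-reflexive (M.Eq.sym q)))

  eval-monotone : ∀ {v w : X → Carrier} {ρ} t →
                  (∀ {x σ} → Occ x σ ρ t → v x ≤⟨ σ ⟩ w x) → eval v t ≤⟨ ρ ⟩ eval w t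
  evalVec-monotone : ∀ {v w : X → Carrier} {n} (κ : Fin n → Sign) (ts : Vec (Term L X) n) →
                     (∀ {x σ} i → Occ x σ (κ i) (lookup ts i) → v x ≤⟨ σ ⟩ w x) →
                     ∀ i → evalVec v ts i ≤⟨ κ i ⟩ evalVec w ts i

  eval-monotone (atom x)   v≤w = v≤w here
  eval-monotone ⊥ᵗ         v≤w = ≤-refl
  eval-monotone ⊤ᵗ         v≤w = ≤-refl
  eval-monotone (s ∧ᵗ t)   v≤w =
    ∧-monotone _ (eval-monotone s (v≤w ∘ ∧ˡ)) (eval-monotone t (v≤w ∘ ∧ʳ))
  eval-monotone (s ∨ᵗ t)   v≤w =
    ∨-monotone _ (eval-monotone s (v≤w ∘ ∨ˡ)) (eval-monotone t (v≤w ∘ ∨ʳ))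
  eval-monotone (con h ts) v≤w = op-monotone h (evalVec-monotone _ ts λ i → v≤w ∘ arg h i)

  evalVec-monotone κ (t ∷ ts) v≤w zero    = eval-monotone t (v≤w zero)
  evalVec-monotone κ (t ∷ ts) v≤w (suc i) = evalVec-monotone (κ ∘ suc) ts (v≤w ∘ suc) i

  eval-cong : ∀ {v w : X → Carrier} t → (∀ {x} → x OccursIn t → v x ≈ w x) → eval v t ≈ eval w t
  eval-cong t v≈w = ≤-antisym { + }
    (eval-monotone t λ o → ≤-reflexive (v≈w (_ , o)))
    (eval-monotone t λ o → ≤-reflexive (M.Eq.sym (v≈w (_ , o))))

  eval-fresh : ∀ {v : X → Carrier} {x u} t → ¬ (x OccursIn t) → eval (v [ x := u ]) t ≈ eval v t
  eval-fresh {v} t x∉t = eval-cong t λ y∈t → M.Eq.reflexive (assign-off v λ { refl → x∉t y∈t })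

  eval-monotone-in : ∀ {θ ρ x} {v w : X → Carrier} t → Uniform θ ρ x t →
                     v x ≤⟨ θ ⟩ w x → (∀ {y} → y ≢ x → v y ≡ w y) → eval v t ≤⟨ ρ ⟩ eval w t
  eval-monotone-in {x = x} {v} {w} t uniform vx≤wx v≡w = eval-monotone t λ {y} o → at y o
    where
    at : ∀ y {σ} → Occ y σ _ t → v y ≤⟨ σ ⟩ w y
    at y o with y ≟ x
    ... | yes refl = subst (Ordered _ _) (sym (uniform o)) vx≤wx
    ... | no y≢x   = ≤-reflexive (M.Eq.reflexive (v≡w y≢x))

  eval-substitute : ∀ (v : X → Carrier) t x s →
                    eval v (substitute t x s) ≈ eval (v [ x := eval v s ]) t
  evalVec-substitute : ∀ (v : X → Carrier) {n} (ts : Vec (Term L X) n) x s i →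
                       evalVec v (substituteVec ts x s) i ≈ evalVec (v [ x := eval v s ]) ts i

  eval-substitute v (atom y) x s with y ≟ x
  ... | yes _ = M.Eq.refl
  ... | no _  = M.Eq.refl
  eval-substitute v ⊥ᵗ         x s = M.Eq.refl
  eval-substitute v ⊤ᵗ         x s = M.Eq.refl
  eval-substitute v (t ∧ᵗ u)   x s = ∧-cong (eval-substitute v t x s) (eval-substitute v u x s)
  eval-substitute v (t ∨ᵗ u)   x s = ∨-cong (eval-substitute v t x s) (eval-substitute v u x s)
  eval-substitute v (con h ts) x s = op-cong h (evalVec-substitute v ts x s)

  evalVec-substitute v (t ∷ ts) x s zero    = eval-substitute v t x s
  evalVec-substitute v (t ∷ ts) x s (suc i) = evalVec-substitute v ts x s i

  evalVec-lookup : ∀ (v : X → Carrier) {n} (ts : Vec (Term L X) n) i →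
                   evalVec v ts i ≡ eval v (lookup ts i)
  evalVec-lookup v (t ∷ ts) zero    = refl
  evalVec-lookup v (t ∷ ts) (suc i) = evalVec-lookup v ts i

  evalVec-update : ∀ (v : X → Carrier) {n} (ts : Vec (Term L X) n) i t j →
                   evalVec v (ts [ i ]≔ t) j ≡ (evalVec v ts [ i ↦ eval v t ]) j
  evalVec-update v (_ ∷ ts) zero    t zero    = refl
  evalVec-update v (_ ∷ ts) zero    t (suc j) = refl
  evalVec-update v (_ ∷ ts) (suc i) t zero    = refl
  evalVec-update v (_ ∷ ts) (suc i) t (suc j) = evalVec-update v ts i t j

  Satisfies : (X → Carrier) → Ineq L X → Set ℓ₂
  Satisfies v e = eval v (lhs e) ≤⟨ + ⟩ eval v (rhs e)

  Satisfies-split : ∀ {v : X → Carrier} {e e₁ e₂} → Splits e e₁ e₂ →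
                    Satisfies v e → Satisfies v e₁ × Satisfies v e₂
  Satisfies-split split-∧ p = ≤-trans p meet-lowerˡ , ≤-trans p meet-lowerʳ
  Satisfies-split split-∨ p = ≤-trans join-upperˡ p , ≤-trans join-upperʳ p

  Satisfies-unsplit : ∀ {v : X → Carrier} {e e₁ e₂} → Splits e e₁ e₂ →
                      Satisfies v e₁ → Satisfies v e₂ → Satisfies v e
  Satisfies-unsplit split-∧ = meet-greatest
  Satisfies-unsplit split-∨ = join-least

  Satisfies-substitute : ∀ {v : X → Carrier} {x s} e →
    (Satisfies v (substituteIneq e x s) → Satisfies (v [ x := eval v s ]) e) ×
    (Satisfies (v [ x := eval v s ]) e → Satisfies v (substituteIneq e x s))
  Satisfies-substitute {v} {x} {s} e =
    (λ p → ≤-trans (≤-reflexive (M.Eq.sym l≈)) (≤-trans p (≤-reflexive r≈))) ,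
    (λ p → ≤-trans (≤-reflexive l≈) (≤-trans p (≤-reflexive (M.Eq.sym r≈))))
    where
    l≈ = eval-substitute v (lhs e) x s
    r≈ = eval-substitute v (rhs e) x s

-- Stage 1

-- Stated for structures, because the rules are applied in the algebra and undone in its canonical
-- extension.
module PreprocessingSound {o c ℓ₁ ℓ₂} {L : Language o} (M : LEStructure L c ℓ₁ ℓ₂)
  (op-monotone : ∀ h → Signed.Monotone (LEStructure.boundedLattice M)
                         (Language.ε L h) (LEStructure.op M h))
  (op-joins : ∀ h → Signed.JoinsAt (LEStructure.boundedLattice M)
                      (polarity h) (Language.ε L h) (LEStructure.op M h)) where

  open Language L
  private module M = LEStructure M
  open M using (Carrier; _≈_; op; eval; evalVec)
  open Signed M.boundedLattice
  open Evaluation M op-monotone _≟ₚ_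
  open Assignment _≟ₚ_ {A = Carrier}
  open Preprocessing L

  Valid : Ineq L PROP → Set (o ⊔ c ⊔ ℓ₂)
  Valid e = ∀ v → Satisfies v e

  -- The extreme value `s` makes the inequality hardest to satisfy: moving `p` to it can only raise
  -- `α` and lower `β`. It is bottom for `θ = +` and top for `θ = -`.
  eliminate : ∀ {α β p s θ} → Uniform (opposite θ) + p α → Uniform θ + p β →
              (∀ {v x} → eval v s ≤⟨ θ ⟩ x) →
              Valid (Substitution.substituteIneq _≟ₚ_ (α ≼ β) p s) → Valid (α ≼ β)
  eliminate {α} {β} {p} {s} α-uniform β-uniform s-least valid v = ≤-trans
    (eval-monotone-in {v = v} α α-uniform
      (flip (subst (_≤⟨ _ ⟩ v p) (sym (assign-at v)) s-least))
      (λ q≢p → sym (assign-off v q≢p)))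
    (≤-trans (proj₁ (Satisfies-substitute (α ≼ β)) (valid v))
      (eval-monotone-in {w = v} β β-uniform
        (subst (_≤⟨ _ ⟩ v p) (sym (assign-at v)) s-least)
        (λ q≢p → assign-off v q≢p)))

  ⟶ᵉ-valid : ∀ {e e′} → e ⟶ᵉ e′ → (Valid e → Valid e′) × (Valid e′ → Valid e)
  ⟶ᵉ-valid (elim-⊥ {α} {β} p _ α-negative β-positive) =
    (λ valid v → proj₂ (Satisfies-substitute (α ≼ β)) (valid _)) ,
    eliminate {θ = + } α-negative β-positive bot-≤
  ⟶ᵉ-valid (elim-⊤ {γ} {δ} p _ γ-positive δ-negative) =
    (λ valid v → proj₂ (Satisfies-substitute (γ ≼ δ)) (valid _)) ,
    eliminate {θ = - } γ-positive δ-negative bot-≤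

  op-distributes : ∀ (v : PROP → Carrier) h ts i {s t} →
    eval v (lookup ts i) ≡ join (polarity h · ε h i) (eval v s) (eval v t) →
    eval v (con h ts) ≈
      join (polarity h) (eval v (con h (ts [ i ]≔ s))) (eval v (con h (ts [ i ]≔ t)))
  op-distributes v h ts i {s} {t} eq = ≤-antisym {polarity h}
    (≤-trans (op-monotone h λ j → ≤-reflexive (M.Eq.reflexive (ts≗ j)))
      (≤-trans (op-joins h i (evalVec v ts))
        (join-least (≤-trans (≤-reflexive (update≈ s)) join-upperˡ)
                    (≤-trans (≤-reflexive (update≈ t)) join-upperʳ))))
    (join-least (≤-trans (≤-reflexive (M.Eq.sym (update≈ s))) (update≤ join-upperˡ))
                (≤-trans (≤-reflexive (M.Eq.sym (update≈ t))) (update≤ join-upperʳ)))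
    where
    at-i : evalVec v ts i ≡ join (polarity h · ε h i) (eval v s) (eval v t)
    at-i = trans (evalVec-lookup v ts i) eq

    ts≗ : ∀ j → evalVec v ts j ≡
                (evalVec v ts [ i ↦ join (polarity h · ε h i) (eval v s) (eval v t) ]) j
    ts≗ = update-elim (λ j x → evalVec v ts j ≡ x) at-i (λ _ _ → refl)

    update≈ : ∀ u → op h (evalVec v ts [ i ↦ eval v u ]) ≈ eval v (con h (ts [ i ]≔ u))
    update≈ u = op-cong h λ j → M.Eq.reflexive (sym (evalVec-update v ts i u j))

    update≤ : ∀ {x} → x ≤⟨ polarity h · ε h i ⟩ join (polarity h · ε h i) (eval v s) (eval v t) →
              op h (evalVec v ts [ i ↦ x ]) ≤⟨ polarity h ⟩ eval v (con h ts)
    update≤ x≤ = op-monotone h (update-elim (λ j x → x ≤⟨ polarity h · ε h j ⟩ evalVec v ts j)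
      (≤-trans x≤ (≤-reflexive (M.Eq.reflexive (sym at-i)))) (λ _ _ → ≤-refl))

  Distributes-eval : ∀ {τ s t} → Distributes τ s t → ∀ v → eval v s ≈ eval v t
  Distributes-eval (f-𝟙 f {ts} i {s} {t} εi≡𝟙 eq) v = op-distributes v (inj₁ f) ts i
    (trans (cong (eval v) eq)
      (cong (λ κ → join (+ · κ) (eval v s) (eval v t)) (sym εi≡𝟙)))
  Distributes-eval (f-∂ f {ts} i {s} {t} εi≡∂ eq) v = op-distributes v (inj₁ f) ts i
    (trans (cong (eval v) eq)
      (cong (λ κ → join (+ · κ) (eval v s) (eval v t)) (sym εi≡∂)))
  Distributes-eval (g-𝟙 g {ts} i {s} {t} εi≡𝟙 eq) v = op-distributes v (inj₂ g) ts i
    (trans (cong (eval v) eq)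
      (cong (λ κ → join (- · κ) (eval v s) (eval v t)) (sym εi≡𝟙)))
  Distributes-eval (g-∂ g {ts} i {s} {t} εi≡∂ eq) v = op-distributes v (inj₂ g) ts i
    (trans (cong (eval v) eq)
      (cong (λ κ → join (- · κ) (eval v s) (eval v t)) (sym εi≡∂)))
  Distributes-eval (∧ˡ d) v = ∧-cong (Distributes-eval d v) M.Eq.refl
  Distributes-eval (∧ʳ d) v = ∧-cong M.Eq.refl (Distributes-eval d v)
  Distributes-eval (∨ˡ d) v = ∨-cong (Distributes-eval d v) M.Eq.refl
  Distributes-eval (∨ʳ d) v = ∨-cong M.Eq.refl (Distributes-eval d v)
  Distributes-eval (arg h {ts} i {t′} d) v = op-cong h λ j →
    subst (evalVec v ts j ≈_) (sym (evalVec-update v ts i t′ j))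
      (update-elim (λ j x → evalVec v ts j ≈ x)
        (M.Eq.trans (M.Eq.reflexive (evalVec-lookup v ts i)) (Distributes-eval d v))
        (λ _ _ → M.Eq.refl) j)

  ⟶ᵈ-valid : ∀ {e e′} → e ⟶ᵈ e′ → (Valid e → Valid e′) × (Valid e′ → Valid e)
  ⟶ᵈ-valid (left d) =
    (λ valid v → ≤-trans (≤-reflexive (M.Eq.sym (Distributes-eval d v))) (valid v)) ,
    (λ valid v → ≤-trans (≤-reflexive (Distributes-eval d v)) (valid v))
  ⟶ᵈ-valid (right d) =
    (λ valid v → ≤-trans (valid v) (≤-reflexive (Distributes-eval d v))) ,
    (λ valid v → ≤-trans (valid v) (≤-reflexive (M.Eq.sym (Distributes-eval d v))))

  ⟶ˢ-valid : ∀ {es es′} → es ⟶ˢ es′ → (All Valid es → All Valid es′) × (All Valid es′ → All Valid es)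
  ⟶ˢ-valid (split es {e} {e₁} {e₂} es′ splits) = forward , backward
    where
    forward : All Valid (es ++ e ∷ es′) → All Valid (es ++ e₁ ∷ e₂ ∷ es′)
    forward all with before , valid ∷ after ← ++⁻ es all =
      ++⁺ before ((λ v → proj₁ (Satisfies-split splits (valid v))) ∷
                  (λ v → proj₂ (Satisfies-split splits (valid v))) ∷ after)

    backward : All Valid (es ++ e₁ ∷ e₂ ∷ es′) → All Valid (es ++ e ∷ es′)
    backward all with before , valid₁ ∷ valid₂ ∷ after ← ++⁻ es all =
      ++⁺ before ((λ v → Satisfies-unsplit splits (valid₁ v) (valid₂ v)) ∷ after)

  Star-valid : ∀ {a r p} {A : Set a} {_⟶_ : A → A → Set r} {P : A → Set p} →
               (∀ {x y} → x ⟶ y → (P x → P y) × (P y → P x)) →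
               ∀ {x y} → Star _⟶_ x y → (P x → P y) × (P y → P x)
  Star-valid step Star.ε        = (λ Px → Px) , (λ Px → Px)
  Star-valid step (x⟶y ◅ y⟶z) =
    (λ Px → proj₁ (Star-valid step y⟶z) (proj₁ (step x⟶y) Px)) ,
    (λ Pz → proj₂ (step x⟶y) (proj₂ (Star-valid step y⟶z) Pz))

  Preprocesses-valid : ∀ {e es} → Preprocesses e es →
                       (Valid e → All Valid es) × (All Valid es → Valid e)
  Preprocesses-valid (e₁ , e₂ , (e⟶e₁ , _) , (e₁⟶e₂ , _) , (e₂⟶es , _)) =
    (λ valid → proj₁ (Star-valid ⟶ˢ-valid e₂⟶es)
      (proj₁ (Star-valid ⟶ᵈ-valid e₁⟶e₂) (proj₁ (Star-valid ⟶ᵉ-valid e⟶e₁) valid) ∷ [])) ,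
    (λ valid → proj₂ (Star-valid ⟶ᵉ-valid e⟶e₁) (proj₂ (Star-valid ⟶ᵈ-valid e₁⟶e₂)
      (All.head (proj₂ (Star-valid ⟶ˢ-valid e₂⟶es) valid))))

-- Algebras and their canonical extensions

module SignedExtension {a ℓ₁ ℓ₂ c e₁ e₂} {B : BoundedLattice a ℓ₁ ℓ₂}
                       (E : CanonicalExtension B c e₁ e₂) where
  private
    module B = BoundedLattice B
    module E = CanonicalExtension E
  open E using (_≤[_]_; K^; O^; ι; s; i)
  open Canonical E

  K^-signed : ∀ κ S {u} → (K^ κ S ≤[ κ ] u → K (+ · κ) S ≤⟨ + · κ ⟩ u) ×
                          (K (+ · κ) S ≤⟨ + · κ ⟩ u → K^ κ S ≤[ κ ] u)
  K^-signed 𝟙 S = pos , pos⁻¹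
  K^-signed ∂ S = neg , neg⁻¹

  O^-signed : ∀ κ S {u} → (u ≤[ κ ] O^ κ S → K (- · κ) S ≤⟨ - · κ ⟩ u) ×
                          (K (- · κ) S ≤⟨ - · κ ⟩ u → u ≤[ κ ] O^ κ S)
  O^-signed 𝟙 S = neg , neg⁻¹
  O^-signed ∂ S = pos , pos⁻¹

  module _ {n} (ε : OrderType n) (f : Vector B.Carrier n → B.Carrier) where

    σ-closed≤ : ∀ S → E.σ-closed ε f (λ j → K^ (ε j) (S j)) ≤⟨ + ⟩ K + (Image ε f + S)
    σ-closed≤ S = K-greatest _ λ { (x , Sx , refl) →
      pos (E.⋀-lower _ (lift (x , λ j → proj₂ (K^-signed (ε j) (S j)) (Gen⇒≤ (Sx j))))) }

    ≤σ-closed : ∀ S → K + (Image ε f + S) ≤⟨ + ⟩ E.σ-closed ε f (λ j → K^ (ε j) (S j))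
    ≤σ-closed S = pos (E.⋀-greatest _ λ { (lift (x , S≤x)) →
      pos⁻¹ (K-lower (Image ε f + S)
        (x , (λ j → ≤⇒Gen (proj₁ (K^-signed (ε j) (S j)) (S≤x j))) , refl)) })

    σ-extends : Extends + ε f (E.σ-extension ε f)
    σ-extends = record
      { least = λ S≤y → pos (E.⋁-least _ λ { (S , S≤u) → pos⁻¹ (≤-trans (σ-closed≤ S)
          (S≤y S λ j → proj₁ (K^-signed (ε j) (S j)) (S≤u j))) })
      ; upper = λ S S≤u → ≤-trans (≤σ-closed S)
          (pos (E.⋁-upper _ (S , λ j → proj₂ (K^-signed (ε j) (S j)) (S≤u j))))
      }

    π-open≤ : ∀ S → E.π-open ε f (λ j → O^ (ε j) (S j)) ≤⟨ - ⟩ K - (Image ε f - S)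
    π-open≤ S = K-greatest _ λ { (x , Sx , refl) →
      neg (E.⋁-upper _ (lift (x , λ j → proj₂ (O^-signed (ε j) (S j)) (Gen⇒≤ (Sx j))))) }

    ≤π-open : ∀ S → K - (Image ε f - S) ≤⟨ - ⟩ E.π-open ε f (λ j → O^ (ε j) (S j))
    ≤π-open S = neg (E.⋁-least _ λ { (lift (x , x≤S)) →
      neg⁻¹ (K-lower (Image ε f - S)
        (x , (λ j → ≤⇒Gen (proj₁ (O^-signed (ε j) (S j)) (x≤S j))) , refl)) })

    π-extends : Extends - ε f (E.π-extension ε f)
    π-extends = record
      { least = λ S≤y → neg (E.⋀-greatest _ λ { (S , u≤S) → neg⁻¹ (≤-trans (π-open≤ S)
          (S≤y S λ j → proj₁ (O^-signed (ε j) (S j)) (u≤S j))) })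
      ; upper = λ S S≤u → ≤-trans (≤π-open S)
          (neg (E.⋀-lower _ (S , λ j → proj₂ (O^-signed (ε j) (S j)) (S≤u j))))
      }

module SignedAlgebra {o a ℓ₁ ℓ₂} {L : Language o} (A : LEAlgebra L a ℓ₁ ℓ₂) where
  open Language L
  private module A = LEAlgebra A
  open A using (_≈_; op; join^; meet^; bottom^; top^)
  open Signed A.boundedLattice

  join^-signed : ∀ κ x y → join (+ · κ) x y ≡ join^ κ x y
  join^-signed 𝟙 x y = refl
  join^-signed ∂ x y = refl

  meet^-signed : ∀ κ x y → join (- · κ) x y ≡ meet^ κ x y
  meet^-signed 𝟙 x y = refl
  meet^-signed ∂ x y = refl

  bottom^-signed : ∀ κ → bot (+ · κ) ≡ bottom^ κ
  bottom^-signed 𝟙 = refl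
  bottom^-signed ∂ = refl

  top^-signed : ∀ κ → bot (- · κ) ≡ top^ κ
  top^-signed 𝟙 = refl
  top^-signed ∂ = refl

  op-join : ∀ h i u x y → op h (u [ i ↦ join (polarity h · ε h i) x y ]) ≈
                          join (polarity h) (op h (u [ i ↦ x ])) (op h (u [ i ↦ y ]))
  op-join h@(inj₁ f) i u x y =
    subst (λ z → op h (u [ i ↦ z ]) ≈ _) (sym (join^-signed (ε h i) x y)) (A.f-join f i u x y)
  op-join h@(inj₂ g) i u x y =
    subst (λ z → op h (u [ i ↦ z ]) ≈ _) (sym (meet^-signed (ε h i) x y)) (A.g-meet g i u x y)

  op-joins : ∀ h → JoinsAt (polarity h) (ε h) (op h)
  op-joins h i u = ≤-reflexive (op-join h i u _ _)

  op-bot : ∀ h i u → op h (u [ i ↦ bot (polarity h · ε h i) ]) ≤⟨ polarity h ⟩ bot (polarity h)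
  op-bot h@(inj₁ f) i u =
    subst (λ z → op h (u [ i ↦ z ]) ≤⟨ + ⟩ _) (sym (bottom^-signed (ε h i)))
      (≤-reflexive (A.f-empty f i u))
  op-bot h@(inj₂ g) i u =
    subst (λ z → op h (u [ i ↦ z ]) ≤⟨ - ⟩ _) (sym (top^-signed (ε h i)))
      (≤-reflexive (A.g-empty g i u))

  -- In one coordinate, `x` below `y` means that their join is `y`, and joins are preserved.
  op-monotone : ∀ h → Monotone (ε h) (op h)
  op-monotone h = monotone (polarity h) {ε = ε h}
    (monotone-by-coordinates _≤⟨ polarity h ⟩_ (λ i x y → x ≤⟨ polarity h · ε h i ⟩ y) ≤-trans (op h)
      (λ u≗w → ≤-reflexive (A.op-cong h λ j → A.Eq.reflexive (u≗w j)))
      (λ i u {x} {y} x≤y → ≤-trans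
        (≤-trans join-upperˡ (≤-reflexive (A.Eq.sym (op-join h i u x y))))
        (≤-reflexive (A.op-cong h (update-elim₂ (λ _ → _≈_)
          (≤-antisym (join-least x≤y ≤-refl) join-upperʳ) (λ _ _ → A.Eq.refl))))))

-- The expanded language interpreted in the canonical extension

module Expansion {o a ℓ₁ ℓ₂ c e₁ e₂} {L : Language o} (A : LEAlgebra L a ℓ₁ ℓ₂)
                 (E : CanonicalExtension (LEAlgebra.boundedLattice A) c e₁ e₂) where
  open Language L
  open LEAlgebra A using (op)
  open CanonicalExtension E using (Carrier)
  open Canonical E
  open SignedExtension E
  open SignedAlgebra A

  Aᵟ : LEStructure L c e₁ e₂
  Aᵟ = canonicalExtension A E

  opᵟ : (h : Conn) → Vector Carrier (arity h) → Carrier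
  opᵟ = LEStructure.op Aᵟ

  opᵟ-extends : ∀ h → Extends (polarity h) (ε h) (op h) (opᵟ h)
  opᵟ-extends h@(inj₁ _) = σ-extends (ε h) (op h)
  opᵟ-extends h@(inj₂ _) = π-extends (ε h) (op h)

  module Opᵟ (h : Conn) =
    Operator (polarity h) (ε h) (op h) (op-monotone h) (op-joins h) (op-bot h) (opᵟ h) (opᵟ-extends h)

  residual : ∀ h → Fin (arity h) → Vector Carrier (arity h) → Carrier
  residual h i = Opᵟ.Residual.residual h i

  op⁺ : (h : Language.Conn (expand L)) → Vector Carrier (Language.arity (expand L) h) → Carrier
  op⁺ (inj₁ (base f))  = opᵟ (inj₁ f)
  op⁺ (inj₁ (♯ f i _)) = residual (inj₁ f) i
  op⁺ (inj₁ (♭ g i _)) = residual (inj₂ g) i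
  op⁺ (inj₂ (base g))  = opᵟ (inj₂ g)
  op⁺ (inj₂ (♯ f i _)) = residual (inj₁ f) i
  op⁺ (inj₂ (♭ g i _)) = residual (inj₂ g) i

  A⁺ : LEStructure (expand L) c e₁ e₂
  A⁺ = record { boundedLattice = CanonicalExtension.completion E ; op = op⁺ }

  opᵟ-monotone : ∀ h → Monotone (ε h) (opᵟ h)
  opᵟ-monotone = Opᵟ.fᵉ-monotone

  opᵟ-joins : ∀ h → JoinsAt (polarity h) (ε h) (opᵟ h)
  opᵟ-joins h i = Opᵟ.Residual.fᵉ-joins h i

  op⁺-monotone : ∀ h → Monotone (Language.ε (expand L) h) (op⁺ h)
  op⁺-monotone (inj₁ (base f))  = opᵟ-monotone (inj₁ f)
  op⁺-monotone (inj₁ (♯ f i _)) = Opᵟ.Residual.residual-monotone (inj₁ f) i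
  op⁺-monotone (inj₁ (♭ g i _)) = Opᵟ.Residual.residual-monotone (inj₂ g) i
  op⁺-monotone (inj₂ (base g))  = opᵟ-monotone (inj₂ g)
  op⁺-monotone (inj₂ (♯ f i _)) = Opᵟ.Residual.residual-monotone (inj₁ f) i
  op⁺-monotone (inj₂ (♭ g i _)) = Opᵟ.Residual.residual-monotone (inj₂ g) i

  -- A new connective is only stable at the sign of its own family.

  data Admits : Sign → Language.Conn (expand L) → Set o where
    base-F : ∀ {ρ} f → Admits ρ (inj₁ (base f))
    base-G : ∀ {ρ} g → Admits ρ (inj₂ (base g))
    ♯-F    : ∀ f i p → Admits + (inj₁ (♯ f i p))
    ♭-F    : ∀ g i p → Admits + (inj₁ (♭ g i p))
    ♯-G    : ∀ f i p → Admits - (inj₂ (♯ f i p))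
    ♭-G    : ∀ g i p → Admits - (inj₂ (♭ g i p))

  -- `κ` is kept apart from `ε h i` so that at a known order-type the sign computes to the one that
  -- `Admits` gives the new connective.
  residual-stable : ∀ h i {κ} → ε h i ≡ κ →
                    Stable (opposite (polarity h · κ)) (adjointType (ε h) i) (residual h i)
  residual-stable h i refl = Opᵟ.Residual.residual-stable h i

  op⁺-stable : ∀ {ρ h} → Admits ρ h → Stable ρ (Language.ε (expand L) h) (op⁺ h)
  op⁺-stable (base-F f)  = Opᵟ.fᵉ-stable (inj₁ f) _
  op⁺-stable (base-G g)  = Opᵟ.fᵉ-stable (inj₂ g) _
  op⁺-stable (♯-F f i p) = residual-stable (inj₁ f) i p
  op⁺-stable (♭-F g i p) = residual-stable (inj₂ g) i p
  op⁺-stable (♯-G f i p) = residual-stable (inj₁ f) i p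
  op⁺-stable (♭-G g i p) = residual-stable (inj₂ g) i p

-- Syntactic closedness

module Closedness {o a ℓ₁ ℓ₂ c e₁ e₂} {L : Language o} (A : LEAlgebra L a ℓ₁ ℓ₂)
              (E : CanonicalExtension (LEAlgebra.boundedLattice A) c e₁ e₂) where
  open Language L using (PROP; _≟ₚ_)
  open Language (expand L) using (ε)
  private module E = CanonicalExtension E
  open E using (Carrier; _≈_; ι; s)
  open Canonical E
  open Expansion A E
  open Expanded L
  open ALBA L
  open LEStructure A⁺ using (eval; evalVec)
  open Evaluation A⁺ op⁺-monotone (atom⁺-≟ _≟ₚ_)
  open Assignment (atom⁺-≟ _≟ₚ_) {A = Carrier}
  open Substitution {L = expand L} (atom⁺-≟ _≟ₚ_)

  -- The terms t whose value is closed (ρ = +) or open (ρ = -) when the variables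
  -- are assigned elements of A; ρ is the sign of the root of t.

  data Syn : Sign → Term⁺ → Set o where
    prop : ∀ {ρ} p → Syn ρ (atom (prop p))
    nom  : ∀ n → Syn + (atom (nom n))
    cnom : ∀ n → Syn - (atom (cnom n))
    ⊥ˢ   : ∀ {ρ} → Syn ρ ⊥ᵗ
    ⊤ˢ   : ∀ {ρ} → Syn ρ ⊤ᵗ
    _∧ˢ_ : ∀ {ρ s t} → Syn ρ s → Syn ρ t → Syn ρ (s ∧ᵗ t)
    _∨ˢ_ : ∀ {ρ s t} → Syn ρ s → Syn ρ t → Syn ρ (s ∨ᵗ t)
    con  : ∀ {ρ h ts} → Admits ρ h → (∀ i → Syn (ρ · ε h i) (lookup ts i)) → Syn ρ (con h ts)

  -- The original connectives are stable at both signs, so a term extracted by approximation may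
  -- stand on either side.
  Syn-embed    : ∀ {ρ} t → Syn ρ (embed t)
  Syn-embedVec : ∀ {n} (κ : Fin n → Sign) (ts : Vec (Term L PROP) n) i →
                 Syn (κ i) (lookup (embedVec ts) i)

  Syn-embed (atom p)          = prop p
  Syn-embed ⊥ᵗ                = ⊥ˢ
  Syn-embed ⊤ᵗ                = ⊤ˢ
  Syn-embed (s ∧ᵗ t)          = Syn-embed s ∧ˢ Syn-embed t
  Syn-embed (s ∨ᵗ t)          = Syn-embed s ∨ˢ Syn-embed t
  Syn-embed (con (inj₁ f) ts) = con (base-F f) (Syn-embedVec _ ts)
  Syn-embed (con (inj₂ g) ts) = con (base-G g) (Syn-embedVec _ ts)

  Syn-embedVec κ (t ∷ ts) zero    = Syn-embed t
  Syn-embedVec κ (t ∷ ts) (suc i) = Syn-embedVec (κ ∘ suc) ts i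

  -- As `p` occurs only with the sign `θ`, the inserted term lands only in places where closedness
  -- of that sign is asked for.
  Syn-substitute : ∀ {θ ρ t p s} → Syn ρ t → Uniform θ ρ (prop p) t → Syn θ s →
                   Syn ρ (substitute t (prop p) s)
  Syn-substitute {p = p} {s} (prop q) uniform s-syn = substitute-atom-elim (atom⁺-≟ _≟ₚ_) (Syn _)
    {x = prop p} {y = prop q} {s}
    (λ { refl → subst (λ σ → Syn σ _) (sym (uniform here)) s-syn }) (λ _ → prop q)
  Syn-substitute (nom n)  uniform s-syn = nom n
  Syn-substitute (cnom n) uniform s-syn = cnom n
  Syn-substitute ⊥ˢ       uniform s-syn = ⊥ˢ
  Syn-substitute ⊤ˢ       uniform s-syn = ⊤ˢ
  Syn-substitute (s ∧ˢ t) uniform s-syn =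
    Syn-substitute s (uniform ∘ ∧ˡ) s-syn ∧ˢ Syn-substitute t (uniform ∘ ∧ʳ) s-syn
  Syn-substitute (s ∨ˢ t) uniform s-syn =
    Syn-substitute s (uniform ∘ ∨ˡ) s-syn ∨ˢ Syn-substitute t (uniform ∘ ∨ʳ) s-syn
  Syn-substitute {p = p} {s} (con {h = h} {ts} admits ts-syn) uniform s-syn =
    con admits λ i → subst (Syn _) (sym (lookup-substituteVec (atom⁺-≟ _≟ₚ_) ts (prop p) s i))
      (Syn-substitute (ts-syn i) (uniform ∘ arg h i) s-syn)

  -- Nominals range over all closed elements rather than the completely
  -- join-irreducible ones, which need not generate Aᵟ constructively.

  record Admissible (v : Atom⁺ PROP → Carrier) : Set (lsuc s ⊔ e₁) where
    constructor admissible
    field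
      nominal   : ∀ n → Closed + (v (nom n))
      conominal : ∀ n → Closed - (v (cnom n))

  open Admissible

  record Clopen (v : Atom⁺ PROP → Carrier) : Set (o ⊔ lsuc s ⊔ e₁) where
    constructor clopen
    field
      admits : Admissible v
      proper : ∀ p → ∃ λ x → v (prop p) ≈ ι x

  open Clopen

  Closed-atom : ∀ {v σ x} → Clopen v → Syn σ (atom x) → Closed σ (v x)
  Closed-atom {σ = σ} v-clopen (prop p) with x , vp≈ ← proper v-clopen p =
    Closed-≈ {σ} vp≈ (Closed-ι {σ} x)
  Closed-atom v-clopen (nom n)  = nominal (admits v-clopen) n
  Closed-atom v-clopen (cnom n) = conominal (admits v-clopen) n

  ∧-closed : ∀ ρ {u w} → Closed ρ u → Closed ρ w → Closed ρ (u E.∧ w)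
  ∧-closed + = Closed-meet { + }
  ∧-closed - = Closed-join { - }

  ∨-closed : ∀ ρ {u w} → Closed ρ u → Closed ρ w → Closed ρ (u E.∨ w)
  ∨-closed + = Closed-join { + }
  ∨-closed - = Closed-meet { - }

  ∧-interpolates : ∀ ρ {u w z} → Closed ρ u → Closed ρ w → u E.∧ w ≤⟨ ρ ⟩ ι z →
    ∃₂ λ x y → u ≤⟨ ρ ⟩ ι x × w ≤⟨ ρ ⟩ ι y × (ι x E.∧ ι y) ≤⟨ ρ ⟩ ι z
  ∧-interpolates + cu cw uw≤z = meet-interpolates cu cw uw≤z
  ∧-interpolates - cu cw uw≤z =
    _ , _ , ≤-trans join-upperˡ uw≤z , ≤-trans join-upperʳ uw≤z , join-least ≤-refl ≤-refl

  ∨-interpolates : ∀ ρ {u w z} → Closed ρ u → Closed ρ w → u E.∨ w ≤⟨ ρ ⟩ ι z →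
    ∃₂ λ x y → u ≤⟨ ρ ⟩ ι x × w ≤⟨ ρ ⟩ ι y × (ι x E.∨ ι y) ≤⟨ ρ ⟩ ι z
  ∨-interpolates + cu cw uw≤z =
    _ , _ , ≤-trans join-upperˡ uw≤z , ≤-trans join-upperʳ uw≤z , join-least ≤-refl ≤-refl
  ∨-interpolates - cu cw uw≤z = meet-interpolates cu cw uw≤z

  -- The hypothesis concerns signed occurrences rather than the whole assignment, because it is also
  -- applied where `p` has a limit value, known to be closed only at one sign.
  Closed-eval : ∀ {v : Atom⁺ PROP → Carrier} {ρ t} → Syn ρ t →
                (∀ {x σ} → Occ x σ ρ t → Syn σ (atom x) → Closed σ (v x)) → Closed ρ (eval v t)
  Closed-eval x@(prop _) atoms = atoms here x
  Closed-eval x@(nom _)  atoms = atoms here x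
  Closed-eval x@(cnom _) atoms = atoms here x
  Closed-eval {ρ = ρ} ⊥ˢ atoms = Closed-≈ {ρ} (E.Eq.sym E.ι-⊥) (Closed-ι {ρ} _)
  Closed-eval {ρ = ρ} ⊤ˢ atoms = Closed-≈ {ρ} (E.Eq.sym E.ι-⊤) (Closed-ι {ρ} _)
  Closed-eval {ρ = ρ} (s ∧ˢ t) atoms =
    ∧-closed ρ (Closed-eval s (atoms ∘ ∧ˡ)) (Closed-eval t (atoms ∘ ∧ʳ))
  Closed-eval {ρ = ρ} (s ∨ˢ t) atoms =
    ∨-closed ρ (Closed-eval s (atoms ∘ ∨ˡ)) (Closed-eval t (atoms ∘ ∨ʳ))
  Closed-eval {v} {ρ} (con {h = h} {ts} admits ts-syn) atoms = Stable.closed (op⁺-stable admits) λ i →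
    subst (Closed (ρ · ε h i)) (sym (evalVec-lookup v ts i))
      (Closed-eval (ts-syn i) (atoms ∘ arg h i))

  -- The topological Ackermann lemma: by compactness, inequalities satisfied at the
  -- limit K θ S of a filter or ideal of A are satisfied at one of its members.

  module _ {v : Atom⁺ PROP → Carrier} (v-clopen : Clopen v)
           (p : PROP) (θ : Sign) (S : Pred (LEAlgebra.Carrier A) s) where

    private
      v₀ : Atom⁺ PROP → Carrier
      v₀ = v [ prop p := K θ S ]

      at : LEAlgebra.Carrier A → Atom⁺ PROP → Carrier
      at a = v [ prop p := ι a ]

    Closed-limit : ∀ {ρ t} → Syn ρ t → Uniform θ ρ (prop p) t → Closed ρ (eval v₀ t)
    Closed-limit {ρ} {t} t-syn uniform = Closed-eval t-syn λ {x} {σ} o x-syn →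
      assign-elim v (Closed σ)
        (λ { refl → subst (λ σ → Closed σ (K θ S)) (sym (uniform o)) (S , E.Eq.refl) })
        (λ _ → Closed-atom v-clopen x-syn)

    eval-shrink : ∀ {ρ a b} t → Uniform θ ρ (prop p) t → b 𝔸.≤⟨ θ ⟩ a →
                  eval (at b) t ≤⟨ ρ ⟩ eval (at a) t
    eval-shrink t uniform b≤a = eval-monotone-in t uniform
      (subst₂ _≤⟨ θ ⟩_ (sym (assign-at v)) (sym (assign-at v)) (ι-mono b≤a))
      (λ y≢ → trans (assign-off v y≢) (sym (assign-off v y≢)))

    Approximated : Sign → Term⁺ → LEAlgebra.Carrier A → Set (s ⊔ e₂)
    Approximated ρ t z = ∃ λ a → Gen θ S a × eval (at a) t ≤⟨ ρ ⟩ ι z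

    interpolates-at-p : ∀ {σ z} → σ ≡ θ → v₀ (prop p) ≤⟨ σ ⟩ ι z →
                        Gen θ S z × at z (prop p) ≤⟨ σ ⟩ ι z
    interpolates-at-p {z = z} refl ≤z =
      ≤⇒Gen (subst (_≤⟨ θ ⟩ ι z) (assign-at v) ≤z) , ≤-reflexive (E.Eq.reflexive (assign-at v))

    -- At a compound term the bound `ι z` first splits into bounds on the arguments by elements of
    -- `A`. The members of the filter found for the arguments are then merged into their meet, to
    -- which monotonicity in `p` allows one to pass. Atoms other than `p` impose no condition, so
    -- the top serves.
    limit-interpolates : ∀ {ρ t z} → Syn ρ t → Uniform θ ρ (prop p) t →
                         eval v₀ t ≤⟨ ρ ⟩ ι z → Approximated ρ t z
    limit-interpolates {ρ} {z = z} (prop q) uniform ≤z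
      with atom⁺-≟ _≟ₚ_ (prop q) (prop p)
    ... | yes refl = z , interpolates-at-p (uniform here) ≤z
    ... | no q≢p = _ , Gen-top ,
      subst (_≤⟨ ρ ⟩ ι z) (trans (assign-off v q≢p) (sym (assign-off v q≢p))) ≤z
    limit-interpolates (nom n)  uniform ≤z = _ , Gen-top , ≤z
    limit-interpolates (cnom n) uniform ≤z = _ , Gen-top , ≤z
    limit-interpolates ⊥ˢ       uniform ≤z = _ , Gen-top , ≤z
    limit-interpolates ⊤ˢ       uniform ≤z = _ , Gen-top , ≤z
    limit-interpolates {ρ} {z = z} (_∧ˢ_ {s = s} {t} s-syn t-syn) uniform ≤z
      with x , y , s≤x , t≤y , xy≤z ← ∧-interpolates ρ
        (Closed-limit s-syn (uniform ∘ ∧ˡ)) (Closed-limit t-syn (uniform ∘ ∧ʳ)) ≤z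
      with a , Sa , sa≤x ← limit-interpolates s-syn (uniform ∘ ∧ˡ) s≤x
         | b , Sb , tb≤y ← limit-interpolates t-syn (uniform ∘ ∧ʳ) t≤y =
      _ , Gen-meet Sa Sb , ≤-trans (∧-monotone ρ
        (≤-trans (eval-shrink s (uniform ∘ ∧ˡ) 𝔸.meet-lowerˡ) sa≤x)
        (≤-trans (eval-shrink t (uniform ∘ ∧ʳ) 𝔸.meet-lowerʳ) tb≤y)) xy≤z
    limit-interpolates {ρ} {z = z} (_∨ˢ_ {s = s} {t} s-syn t-syn) uniform ≤z
      with x , y , s≤x , t≤y , xy≤z ← ∨-interpolates ρ
        (Closed-limit s-syn (uniform ∘ ∨ˡ)) (Closed-limit t-syn (uniform ∘ ∨ʳ)) ≤z
      with a , Sa , sa≤x ← limit-interpolates s-syn (uniform ∘ ∨ˡ) s≤x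
         | b , Sb , tb≤y ← limit-interpolates t-syn (uniform ∘ ∨ʳ) t≤y =
      _ , Gen-meet Sa Sb , ≤-trans (∨-monotone ρ
        (≤-trans (eval-shrink s (uniform ∘ ∨ˡ) 𝔸.meet-lowerˡ) sa≤x)
        (≤-trans (eval-shrink t (uniform ∘ ∨ʳ) 𝔸.meet-lowerʳ) tb≤y)) xy≤z
    limit-interpolates {ρ} {z = z} (con {h = h} {ts} admits ts-syn) uniform ≤z
      with y , ts≤y , fy≤z ← Stable.interpolates (op⁺-stable admits) {u = evalVec v₀ ts}
        (λ i → subst (Closed (ρ · ε h i)) (sym (evalVec-lookup v₀ ts i))
          (Closed-limit (ts-syn i) (uniform ∘ arg h i))) ≤z
      with a , Sa , ts≤ ← Gen-common
        (λ i a → eval (at a) (lookup ts i) ≤⟨ ρ · ε h i ⟩ ι (y i))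
        (λ i b≤a ≤y → ≤-trans (eval-shrink (lookup ts i) (uniform ∘ arg h i) b≤a) ≤y)
        (λ i → limit-interpolates (ts-syn i) (uniform ∘ arg h i)
          (subst (_≤⟨ ρ · ε h i ⟩ ι (y i)) (evalVec-lookup v₀ ts i) (ts≤y i))) =
      a , Sa , ≤-trans (op⁺-monotone h λ i →
        subst (_≤⟨ ρ · ε h i ⟩ ι (y i)) (sym (evalVec-lookup (at a) ts i)) (ts≤ i)) fy≤z

    -- Compactness puts an element `z` of `A` between the closed left and the open right value, so
    -- the two sides are approximated separately. Uniformity is returned with the result because
    -- merging the witnesses of several inequalities requires passing to smaller members.
    single : ∀ e → Syn + (lhs e) × Syn - (rhs e) →
             Uniform θ + (prop p) (lhs e) × Uniform θ - (prop p) (rhs e) → Satisfies v₀ e →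
             ∃ λ a → Gen θ S a × (Uniform θ + (prop p) (lhs e) × Uniform θ - (prop p) (rhs e)) ×
                     Satisfies (at a) e
    single e (l-syn , r-syn) (ul , ur) sat
      with z , l≤z , z≤r ← interpolate (Closed-limit l-syn ul) (Closed-limit r-syn ur) sat
      with a , Sa , la≤z ← limit-interpolates l-syn ul l≤z
         | b , Sb , rb≤z ← limit-interpolates r-syn ur (flip z≤r) =
      _ , Gen-meet Sa Sb , (ul , ur) ,
      ≤-trans (eval-shrink (lhs e) ul 𝔸.meet-lowerˡ) (≤-trans la≤z
        (≤-trans (unflip rb≤z) (unflip (eval-shrink (rhs e) ur 𝔸.meet-lowerʳ))))

    topological-ackermann : ∀ {es} →
      All (λ e → Syn + (lhs e) × Syn - (rhs e)) es →
      All (λ e → Uniform θ + (prop p) (lhs e) × Uniform θ - (prop p) (rhs e)) es →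
      All (Satisfies v₀) es → ∃ λ a → Gen θ S a × All (Satisfies (at a)) es
    topological-ackermann {es} syns uniforms sats
      with a , Sa , all ← Gen-common-All
        (λ e a → (Uniform θ + (prop p) (lhs e) × Uniform θ - (prop p) (rhs e)) ×
                 Satisfies (at a) e)
        (λ { {e} b≤a ((ul , ur) , sat) → (ul , ur) ,
             ≤-trans (eval-shrink (lhs e) ul b≤a) (≤-trans sat (unflip (eval-shrink (rhs e) ur b≤a))) })
        (All.zipWith (λ { {e} (syn , uniform , sat) → single e syn uniform sat })
          (syns , All.zip (uniforms , sats))) =
      a , Sa , All.map proj₂ all

-- Stage 2

module Reduction {o a ℓ₁ ℓ₂ c e₁ e₂} {L : Language o} (A : LEAlgebra L a ℓ₁ ℓ₂)
                 (E : CanonicalExtension (LEAlgebra.boundedLattice A) c e₁ e₂) where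
  open Language L using (PROP; _≟ₚ_; arity) renaming (ε to εᴸ)
  private
    module E = CanonicalExtension E
    module A = LEAlgebra A
  open E using (Carrier; _≈_; ι; s)
  open Canonical E
  open Expansion A E
  open Closedness A E
  open Admissible
  open Clopen
  open Expanded L
  open ALBA L
  open LEStructure A⁺ using (eval; evalVec)
  open Evaluation A⁺ op⁺-monotone (atom⁺-≟ _≟ₚ_)
  open Assignment (atom⁺-≟ _≟ₚ_) {A = Carrier}
  open Substitution {L = expand L} (atom⁺-≟ _≟ₚ_)

  Satisfies-≈ : ∀ {v w : Atom⁺ PROP → Carrier} e →
                (∀ {x} → x OccursInIneq e → v x ≈ w x) → Satisfies v e → Satisfies w e
  Satisfies-≈ e v≈w sat =
    ≤-trans (≤-reflexive (eval-cong (lhs e) λ x∈ → E.Eq.sym (v≈w (inj₁ x∈))))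
      (≤-trans sat (≤-reflexive (eval-cong (rhs e) λ x∈ → v≈w (inj₂ x∈))))

  Satisfies-assign : ∀ {v : Atom⁺ PROP → Carrier} {x u} e → ¬ (x OccursInIneq e) →
                     Satisfies v e → Satisfies (v [ x := u ]) e
  Satisfies-assign {v} e x∉e = Satisfies-≈ e λ y∈e →
    E.Eq.reflexive (sym (assign-off v λ { refl → x∉e y∈e }))

  Satisfies-unassign : ∀ {v : Atom⁺ PROP → Carrier} {x u} e → ¬ (x OccursInIneq e) →
                       Satisfies (v [ x := u ]) e → Satisfies v e
  Satisfies-unassign {v} e x∉e = Satisfies-≈ e λ y∈e →
    E.Eq.reflexive (assign-off v λ { refl → x∉e y∈e })

  -- The context as a function of the value in the hole, which need not be the value of a term.
  ⟦_⟧ : ∀ {σ τ} → SLRContext σ τ → (Atom⁺ PROP → Carrier) → Carrier → Carrier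
  ⟦ hole ⟧            v x = x
  ⟦ f-node f ts i C ⟧ v x = opᵟ (inj₁ f) (evalVec v ts [ i ↦ ⟦ C ⟧ v x ])
  ⟦ g-node g ts i C ⟧ v x = opᵟ (inj₂ g) (evalVec v ts [ i ↦ ⟦ C ⟧ v x ])

  eval-plug : ∀ {σ τ} (C : SLRContext σ τ) v t → eval v (C ⟨ t ⟩) ≈ ⟦ C ⟧ v (eval v t)
  eval-plug hole v t = E.Eq.refl
  eval-plug (f-node f ts i C) v t = op-cong (inj₁ (base f)) λ j → E.Eq.trans
    (E.Eq.reflexive (evalVec-update v ts i (C ⟨ t ⟩) j))
    (update-elim₂ (λ _ → _≈_) {u = evalVec v ts} {w = evalVec v ts}
      (eval-plug C v t) (λ _ _ → E.Eq.refl) j)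
  eval-plug (g-node g ts i C) v t = op-cong (inj₂ (base g)) λ j → E.Eq.trans
    (E.Eq.reflexive (evalVec-update v ts i (C ⟨ t ⟩) j))
    (update-elim₂ (λ _ → _≈_) {u = evalVec v ts} {w = evalVec v ts}
      (eval-plug C v t) (λ _ _ → E.Eq.refl) j)

  ⟦⟧-monotone : ∀ {σ τ} (C : SLRContext σ τ) v {x y} → x ≤⟨ σ ⟩ y → ⟦ C ⟧ v x ≤⟨ τ ⟩ ⟦ C ⟧ v y
  ⟦⟧-monotone hole v x≤y = x≤y
  ⟦⟧-monotone (f-node f ts i C) v x≤y = opᵟ-monotone (inj₁ f)
    (update-elim₂ (λ j → _≤⟨ + · εᴸ (inj₁ f) j ⟩_) {u = evalVec v ts} {w = evalVec v ts}
      (⟦⟧-monotone C v x≤y) (λ _ _ → ≤-refl))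
  ⟦⟧-monotone (g-node g ts i C) v x≤y = opᵟ-monotone (inj₂ g)
    (update-elim₂ (λ j → _≤⟨ - · εᴸ (inj₂ g) j ⟩_) {u = evalVec v ts} {w = evalVec v ts}
      (⟦⟧-monotone C v x≤y) (λ _ _ → ≤-refl))

  -- An SLR context is a left adjoint, hence determined by its values at the
  -- closed (or open) elements below a given one.

  ⟦⟧-dense : ∀ {σ τ} (C : SLRContext σ τ) v {x y} →
             (∀ S → K σ S ≤⟨ σ ⟩ x → ⟦ C ⟧ v (K σ S) ≤⟨ τ ⟩ y) → ⟦ C ⟧ v x ≤⟨ τ ⟩ y
  ⟦⟧-dense hole v C≤y = ≤-dense C≤y
  ⟦⟧-dense (f-node f ts i C) v C≤y = Opᵟ.Residual.adjoint⇐ (inj₁ f) i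
    (⟦⟧-dense C v λ S S≤x → Opᵟ.Residual.adjoint⇒ (inj₁ f) i (C≤y S S≤x))
  ⟦⟧-dense (g-node g ts i C) v C≤y = Opᵟ.Residual.adjoint⇐ (inj₂ g) i
    (⟦⟧-dense C v λ S S≤x → Opᵟ.Residual.adjoint⇒ (inj₂ g) i (C≤y S S≤x))

  -- Restricted to `j ≢ i`: the `i`-th entry of `ts` is a dummy, about which freshness in the
  -- plugged term says nothing.
  evalVec-fresh : ∀ h {ts : Vec Term⁺ (Language.arity (expand L) h)} {i t x u v} →
                  Fresh x (con h (ts [ i ]≔ t)) → ∀ j → j ≢ i →
                  evalVec (v [ x := u ]) ts j ≈ evalVec v ts j
  evalVec-fresh h {ts} {i} {t} {x} {u} {v} x∉ j j≢i =
    E.Eq.trans (E.Eq.reflexive (evalVec-lookup _ ts j))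
      (E.Eq.trans
        (eval-fresh (lookup ts j) (λ { (σ , o) → Fresh-arg {h = h} x∉ j
          (subst (Occ x σ +) (sym (lookup∘update′ j≢i ts t)) o) }))
        (E.Eq.reflexive (sym (evalVec-lookup v ts j))))

  Fresh-hole : ∀ {σ τ} (C : SLRContext σ τ) {t x} → Fresh x (C ⟨ t ⟩) → Fresh x t
  Fresh-hole hole x∉ = x∉
  Fresh-hole (f-node f ts i C) {t} x∉ = Fresh-hole C {t}
    (subst (Fresh _) (lookup∘update i ts (C ⟨ t ⟩)) (Fresh-arg {h = inj₁ (base f)} x∉ i))
  Fresh-hole (g-node g ts i C) {t} x∉ = Fresh-hole C {t}
    (subst (Fresh _) (lookup∘update i ts (C ⟨ t ⟩)) (Fresh-arg {h = inj₂ (base g)} x∉ i))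

  ⟦⟧-fresh : ∀ {σ τ} (C : SLRContext σ τ) {v t x u z} → Fresh x (C ⟨ t ⟩) →
             ⟦ C ⟧ (v [ x := u ]) z ≈ ⟦ C ⟧ v z
  ⟦⟧-fresh hole x∉ = E.Eq.refl
  ⟦⟧-fresh (f-node f ts i C) {t = t} x∉ = op-cong (inj₁ (base f))
    (update-elim₂ (λ _ → _≈_)
      (⟦⟧-fresh C {t = t}
        (subst (Fresh _) (lookup∘update i ts (C ⟨ t ⟩)) (Fresh-arg {h = inj₁ (base f)} x∉ i)))
      (evalVec-fresh (inj₁ (base f)) x∉))
  ⟦⟧-fresh (g-node g ts i C) {t = t} x∉ = op-cong (inj₂ (base g))
    (update-elim₂ (λ _ → _≈_)
      (⟦⟧-fresh C {t = t}
        (subst (Fresh _) (lookup∘update i ts (C ⟨ t ⟩)) (Fresh-arg {h = inj₂ (base g)} x∉ i)))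
      (evalVec-fresh (inj₂ (base g)) x∉))

  assign-admissible : ∀ {v σ u} n → Admissible v → Closed σ u → Admissible (v [ approximant σ n := u ])
  assign-admissible {v} {σ = + } n adm u-closed = admissible
    (λ m → assign-elim v {nom n} {y = nom m} (Closed +) (λ _ → u-closed) (λ _ → nominal adm m))
    (conominal adm)
  assign-admissible {v} {σ = - } n adm u-closed = admissible
    (nominal adm)
    (λ m → assign-elim v {cnom n} {y = cnom m} (Closed -) (λ _ → u-closed) (λ _ → conominal adm m))

  Satisfies-bound⇒ : ∀ {v : Atom⁺ PROP → Carrier} σ {n γ} → Satisfies v (bound σ n γ) →
                     v (approximant σ n) ≤⟨ σ ⟩ eval v γ
  Satisfies-bound⇒ + sat = sat
  Satisfies-bound⇒ - sat = flip sat

  Satisfies-bound⇐ : ∀ {v : Atom⁺ PROP → Carrier} σ {n γ} →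
                     v (approximant σ n) ≤⟨ σ ⟩ eval v γ → Satisfies v (bound σ n γ)
  Satisfies-bound⇐ + below = below
  Satisfies-bound⇐ - below = unflip below

  plug-monotone : ∀ {v : Atom⁺ PROP → Carrier} {σ τ} (C : SLRContext σ τ) {s t} →
                  eval v s ≤⟨ σ ⟩ eval v t → eval v (C ⟨ s ⟩) ≤⟨ τ ⟩ eval v (C ⟨ t ⟩)
  plug-monotone {v} C {s} {t} s≤t =
    ≤-trans (≤-reflexive (eval-plug C v s))
      (≤-trans (⟦⟧-monotone C v s≤t) (≤-reflexive (E.Eq.sym (eval-plug C v t))))

  -- Density reduces the hole to closed elements below the value of `γ`. Each of these is made the
  -- value of the fresh atom, which leaves the rest of the context unchanged.
  plug-approximation : ∀ {v : Atom⁺ PROP → Carrier} {σ τ} (C : SLRContext σ τ) γ n {y} →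
    Admissible v → ¬ (approximant σ n OccursIn (C ⟨ embed γ ⟩)) →
    (∀ {u} → Closed σ u → u ≤⟨ σ ⟩ eval v (embed γ) →
      eval (v [ approximant σ n := u ]) (C ⟨ atom (approximant σ n) ⟩) ≤⟨ τ ⟩ y) →
    eval v (C ⟨ embed γ ⟩) ≤⟨ τ ⟩ y
  plug-approximation {v} {σ} C γ n adm x∉ approximated =
    ≤-trans (≤-reflexive (eval-plug C v (embed γ)))
      (⟦⟧-dense C v λ S S≤γ → ≤-trans
        (≤-reflexive (E.Eq.trans
          (E.Eq.sym (⟦⟧-fresh C {t = embed γ} (fresh x∉)))
          (E.Eq.trans
            (E.Eq.reflexive (cong (⟦ C ⟧ _) (sym (assign-at v))))
            (E.Eq.sym (eval-plug C _ (atom (approximant σ n)))))))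
        (approximated (S , E.Eq.refl) S≤γ))

  SynIneq : Ineq⁺ → Set o
  SynIneq e = Syn + (lhs e) × Syn - (rhs e)

  Holds : (Atom⁺ PROP → Carrier) → System → Set (o ⊔ e₂)
  Holds v (S , I) = All (Satisfies v) S → Satisfies v I

  -- A closed `u` below `γ`, given to the fresh atom, satisfies the new bound and changes nothing in
  -- `S`. What depends on the side of the inequality is confined to `reduce`.
  approximation-backward : ∀ {S σ} I I′ γ n → (∀ {v} → Admissible v →
      (∀ {u} → Closed σ u → u ≤⟨ σ ⟩ eval v (embed γ) → Satisfies (v [ approximant σ n := u ]) I′) →
      Satisfies v I) →
    ¬ Any (approximant σ n OccursInIneq_) S → ¬ (approximant σ n OccursIn embed γ) →
    (∀ v → Admissible v → Holds v (bound σ n (embed γ) ∷ S , I′)) →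
    ∀ v → Admissible v → Holds v (S , I)
  approximation-backward {S} {σ} I I′ γ n reduce x∉S x∉γ holds v adm sats =
    reduce adm λ {u} u-closed u≤γ → holds _ (assign-admissible n adm u-closed)
      (Satisfies-bound⇐ σ {γ = embed γ}
        (≤-trans (≤-reflexive (E.Eq.reflexive (assign-at v)))
          (≤-trans u≤γ (≤-reflexive (E.Eq.sym (eval-fresh (embed γ) x∉γ))))) ∷
       All.zipWith (λ { {e} (x∉e , sat) → Satisfies-assign e x∉e sat }) (¬Any⇒All¬ S x∉S , sats))

  approximateˡ-backward : ∀ {S ψ σ} (C : SLRContext σ +) γ n →
    ¬ (approximant σ n OccursInSystem (S , (C ⟨ embed γ ⟩ ≼ ψ))) →
    (∀ v → Admissible v → Holds v (bound σ n (embed γ) ∷ S , (C ⟨ atom (approximant σ n) ⟩ ≼ ψ))) →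
    ∀ v → Admissible v → Holds v (S , (C ⟨ embed γ ⟩ ≼ ψ))
  approximateˡ-backward {ψ = ψ} C γ n x∉ = approximation-backward
    (C ⟨ embed γ ⟩ ≼ ψ) (C ⟨ atom _ ⟩ ≼ ψ) γ n
    (λ adm sat → plug-approximation C γ n adm (x∉ ∘ inj₂ ∘ inj₁) λ u-closed u≤γ →
      ≤-trans (sat u-closed u≤γ) (≤-reflexive (eval-fresh ψ (x∉ ∘ inj₂ ∘ inj₂))))
    (x∉ ∘ inj₁)
    (λ { (_ , o) → Fresh-hole C {embed γ} (fresh (x∉ ∘ inj₂ ∘ inj₁)) o })

  approximateʳ-backward : ∀ {S φ σ} (C : SLRContext σ -) γ n →
    ¬ (approximant σ n OccursInSystem (S , (φ ≼ C ⟨ embed γ ⟩))) →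
    (∀ v → Admissible v → Holds v (bound σ n (embed γ) ∷ S , (φ ≼ C ⟨ atom (approximant σ n) ⟩))) →
    ∀ v → Admissible v → Holds v (S , (φ ≼ C ⟨ embed γ ⟩))
  approximateʳ-backward {φ = φ} C γ n x∉ = approximation-backward
    (φ ≼ C ⟨ embed γ ⟩) (φ ≼ C ⟨ atom _ ⟩) γ n
    (λ adm sat → unflip (plug-approximation C γ n adm (x∉ ∘ inj₂ ∘ inj₂) λ u-closed u≤γ →
      flip (≤-trans (≤-reflexive (E.Eq.sym (eval-fresh φ (x∉ ∘ inj₂ ∘ inj₁)))) (sat u-closed u≤γ))))
    (x∉ ∘ inj₁)
    (λ { (_ , o) → Fresh-hole C {embed γ} (fresh (x∉ ∘ inj₂ ∘ inj₂)) o })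

  residuation⇒ : ∀ (v : Atom⁺ PROP → Carrier) h ts ψ i {κ} → εᴸ h i ≡ κ →
    opᵟ h (evalVec v ts) ≤⟨ polarity h ⟩ eval v ψ →
    eval v (lookup ts i) ≤⟨ polarity h · κ ⟩ residual h i (evalVec v (ts [ i ]≔ ψ))
  residuation⇒ v h ts ψ i refl f≤ψ =
    subst (_≤⟨ polarity h · εᴸ h i ⟩ residual h i (evalVec v (ts [ i ]≔ ψ)))
      (evalVec-lookup v ts i)
      (Opᵟ.Residual.residual-≥ h i
        (λ j j≢i → ≤-reflexive (E.Eq.reflexive (trans (evalVec-update v ts i ψ j)
          (updateAt-minimal j i (evalVec v ts) j≢i))))
        (≤-trans f≤ψ (≤-reflexive (E.Eq.reflexive (sym (trans (evalVec-update v ts i ψ i)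
          (updateAt-updates i (evalVec v ts))))))))

  residuation⇐ : ∀ (v : Atom⁺ PROP → Carrier) h ts ψ i {κ} → εᴸ h i ≡ κ →
    eval v (lookup ts i) ≤⟨ polarity h · κ ⟩ residual h i (evalVec v (ts [ i ]≔ ψ)) →
    opᵟ h (evalVec v ts) ≤⟨ polarity h ⟩ eval v ψ
  residuation⇐ v h ts ψ i refl ti≤ = ≤-trans
    (Opᵟ.Residual.residual-≤ h i
      (λ j j≢i → ≤-reflexive (E.Eq.reflexive (sym (trans (evalVec-update v ts i ψ j)
        (updateAt-minimal j i (evalVec v ts) j≢i)))))
      (subst (_≤⟨ polarity h · εᴸ h i ⟩ residual h i (evalVec v (ts [ i ]≔ ψ)))
        (sym (evalVec-lookup v ts i)) ti≤))
    (≤-reflexive (E.Eq.reflexive (trans (evalVec-update v ts i ψ i)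
      (updateAt-updates i (evalVec v ts)))))

  Residuates-Satisfies : ∀ {e e′} → Residuates e e′ → ∀ {v} →
                         (Satisfies v e → Satisfies v e′) × (Satisfies v e′ → Satisfies v e)
  Residuates-Satisfies (f-𝟙 f ts ψ i p) {v} =
    residuation⇒ v (inj₁ f) ts ψ i p , residuation⇐ v (inj₁ f) ts ψ i p
  Residuates-Satisfies (f-∂ f ts ψ i p) {v} =
    unflip ∘ residuation⇒ v (inj₁ f) ts ψ i p , residuation⇐ v (inj₁ f) ts ψ i p ∘ flip
  Residuates-Satisfies (g-𝟙 g ts ψ i p) {v} =
    unflip ∘ residuation⇒ v (inj₂ g) ts ψ i p ∘ flip , unflip ∘ residuation⇐ v (inj₂ g) ts ψ i p ∘ flip
  Residuates-Satisfies (g-∂ g ts ψ i p) {v} =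
    residuation⇒ v (inj₂ g) ts ψ i p ∘ flip , unflip ∘ residuation⇐ v (inj₂ g) ts ψ i p

  Syn-argument : ∀ h (ts : Vec Term⁺ (arity h)) i {κ} → εᴸ h i ≡ κ →
    (∀ j → Syn (polarity h · εᴸ h j) (lookup ts j)) → Syn (polarity h · κ) (lookup ts i)
  Syn-argument h ts i refl ts-syn = ts-syn i

  Syn-residual : ∀ h (ts : Vec Term⁺ (arity h)) {ψ} i {κ} → εᴸ h i ≡ κ →
    (∀ j → Syn (polarity h · εᴸ h j) (lookup ts j)) → Syn (opposite (polarity h)) ψ →
    ∀ j → Syn (opposite (polarity h · κ) · adjointType (εᴸ h) i j) (lookup (ts [ i ]≔ ψ) j)
  Syn-residual h ts {ψ} i refl ts-syn ψ-syn = split-at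
    (λ j → Syn (opposite (polarity h · εᴸ h i) · adjointType (εᴸ h) i j) (lookup (ts [ i ]≔ ψ) j))
    (subst₂ Syn (sym (adjointType-at (polarity h) (εᴸ h) i)) (sym (lookup∘update i ts ψ)) ψ-syn)
    (λ j j≢i → subst₂ Syn (sym (adjointType-off (polarity h) (εᴸ h) j≢i))
      (sym (lookup∘update′ j≢i ts ψ)) (ts-syn j))

  -- A new connective appears on the left if it belongs to `F*` and on the right if it belongs to
  -- `G*`, which is the sign at which it is stable.
  Residuates-Syn : ∀ {e e′} → Residuates e e′ → SynIneq e → SynIneq e′
  Residuates-Syn (f-𝟙 f ts ψ i p) (con _ ts-syn , ψ-syn) =
    Syn-argument (inj₁ f) ts i p ts-syn ,
    con (♯-G f i p) (Syn-residual (inj₁ f) ts i p ts-syn ψ-syn)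
  Residuates-Syn (f-∂ f ts ψ i p) (con _ ts-syn , ψ-syn) =
    con (♯-F f i p) (Syn-residual (inj₁ f) ts i p ts-syn ψ-syn) ,
    Syn-argument (inj₁ f) ts i p ts-syn
  Residuates-Syn (g-𝟙 g ts ψ i p) (ψ-syn , con _ ts-syn) =
    con (♭-F g i p) (Syn-residual (inj₂ g) ts i p ts-syn ψ-syn) ,
    Syn-argument (inj₂ g) ts i p ts-syn
  Residuates-Syn (g-∂ g ts ψ i p) (ψ-syn , con _ ts-syn) =
    Syn-argument (inj₂ g) ts i p ts-syn ,
    con (♭-G g i p) (Syn-residual (inj₂ g) ts i p ts-syn ψ-syn)

  Splits-Syn : ∀ {e e₁ e₂} → Splits e e₁ e₂ → SynIneq e → SynIneq e₁ × SynIneq e₂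
  Splits-Syn split-∧ (α , β ∧ˢ γ) = (α , β) , (α , γ)
  Splits-Syn split-∨ (α ∨ˢ β , γ) = (α , γ) , (β , γ)

  -- Ackermann rules, uniformly in the sign: θ = + is the right rule, θ = - the left one

  ⨆ᵗ : Sign → List Term⁺ → Term⁺
  ⨆ᵗ + = ⋁ᵗ
  ⨆ᵗ - = ⋀ᵗ

  eval-⨆ᵗ-upper : ∀ (v : Atom⁺ PROP → Carrier) θ αs → All (λ α → eval v α ≤⟨ θ ⟩ eval v (⨆ᵗ θ αs)) αs
  eval-⨆ᵗ-upper v θ []               = []
  eval-⨆ᵗ-upper v + (α ∷ [])         = ≤-refl ∷ []
  eval-⨆ᵗ-upper v - (α ∷ [])         = ≤-refl ∷ []
  eval-⨆ᵗ-upper v + (α ∷ αs@(_ ∷ _)) =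
    join-upperˡ ∷ All.map (λ ≤⨆ → ≤-trans ≤⨆ join-upperʳ) (eval-⨆ᵗ-upper v + αs)
  eval-⨆ᵗ-upper v - (α ∷ αs@(_ ∷ _)) =
    join-upperˡ ∷ All.map (λ ≤⨆ → ≤-trans ≤⨆ join-upperʳ) (eval-⨆ᵗ-upper v - αs)

  eval-⨆ᵗ-least : ∀ (v : Atom⁺ PROP → Carrier) θ {αs x} → All (λ α → eval v α ≤⟨ θ ⟩ x) αs →
                  eval v (⨆ᵗ θ αs) ≤⟨ θ ⟩ x
  eval-⨆ᵗ-least v + []              = bot-≤
  eval-⨆ᵗ-least v - []              = bot-≤
  eval-⨆ᵗ-least v + (p ∷ [])        = p
  eval-⨆ᵗ-least v - (p ∷ [])        = p
  eval-⨆ᵗ-least v + (p ∷ ps@(_ ∷ _)) = join-least p (eval-⨆ᵗ-least v + ps)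
  eval-⨆ᵗ-least v - (p ∷ ps@(_ ∷ _)) = join-least p (eval-⨆ᵗ-least v - ps)

  Syn-⨆ᵗ : ∀ θ {αs} → All (Syn θ) αs → Syn θ (⨆ᵗ θ αs)
  Syn-⨆ᵗ + []               = ⊥ˢ
  Syn-⨆ᵗ - []               = ⊤ˢ
  Syn-⨆ᵗ + (α ∷ [])         = α
  Syn-⨆ᵗ - (α ∷ [])         = α
  Syn-⨆ᵗ + (α ∷ αs@(_ ∷ _)) = α ∨ˢ Syn-⨆ᵗ + αs
  Syn-⨆ᵗ - (α ∷ αs@(_ ∷ _)) = α ∧ˢ Syn-⨆ᵗ - αs

  bounds : Sign → PROP → List Term⁺ → List Ineq⁺
  bounds + p = map (_≼ atom (prop p))
  bounds - p = map (atom (prop p) ≼_)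

  Satisfies-bounds⇒ : ∀ {v : Atom⁺ PROP → Carrier} θ p {αs} → All (Satisfies v) (bounds θ p αs) →
                      All (λ α → eval v α ≤⟨ θ ⟩ v (prop p)) αs
  Satisfies-bounds⇒ + p sats = map⁻ sats
  Satisfies-bounds⇒ - p sats = All.map flip (map⁻ sats)

  Satisfies-bounds⇐ : ∀ {v : Atom⁺ PROP → Carrier} θ p {αs} →
                      All (λ α → eval v α ≤⟨ θ ⟩ v (prop p)) αs → All (Satisfies v) (bounds θ p αs)
  Satisfies-bounds⇐ + p αs≤p = map⁺ αs≤p
  Satisfies-bounds⇐ - p αs≤p = map⁺ (All.map unflip αs≤p)

  Syn-bounds : ∀ θ {p αs} → All SynIneq (bounds θ p αs) → All (Syn θ) αs
  Syn-bounds + syns = All.map proj₁ (map⁻ syns)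
  Syn-bounds - syns = All.map proj₂ (map⁻ syns)

  UniformIneq : Sign → PROP → Ineq⁺ → Set o
  UniformIneq θ p e = Uniform θ + (prop p) (lhs e) × Uniform θ - (prop p) (rhs e)

  module Ackermann {θ : Sign} {p : PROP} {I : Ineq⁺} {αs : List Term⁺} {es : List Ineq⁺}
                   (p∉αs : All (λ α → ¬ (prop p OccursIn α)) αs)
                   (p∉I : ¬ (prop p OccursInIneq I)) (uniforms : All (UniformIneq θ p) es) where

    substituted : List Ineq⁺
    substituted = map (λ e → substituteIneq e (prop p) (⨆ᵗ θ αs)) es

    substituted-Syn : All SynIneq (bounds θ p αs ++ es) → All SynIneq substituted
    substituted-Syn syns = map⁺ (All.zipWith
      (λ { ((l-syn , r-syn) , (l-uniform , r-uniform)) →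
        Syn-substitute l-syn l-uniform ⨆-syn , substitute-r r-syn r-uniform })
      (++⁻ʳ (bounds θ p αs) syns , uniforms))
      where
      ⨆-syn : Syn θ (⨆ᵗ θ αs)
      ⨆-syn = Syn-⨆ᵗ θ (Syn-bounds θ (++⁻ˡ (bounds θ p αs) syns))

      substitute-r : ∀ {t} → Syn - t → Uniform θ - (prop p) t →
                     Syn - (substitute t (prop p) (⨆ᵗ θ αs))
      substitute-r t-syn uniform = Syn-substitute t-syn uniform ⨆-syn

    -- Here `v` already puts `p` beyond all of `αs`, hence beyond their join in the sign `θ`, and
    -- uniformity allows `p` to be moved to that join.
    backward : (∀ v → Admissible v → Holds v (substituted , I)) →
               ∀ v → Admissible v → Holds v (bounds θ p αs ++ es , I)
    backward holds v adm sats = holds v adm (map⁺ (All.zipWith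
      (λ { {e} ((l-uniform , r-uniform) , sat) → proj₂ (Satisfies-substitute e)
        (≤-trans (eval-monotone-in (lhs e) l-uniform ⨆≤p (assign-off v))
          (≤-trans sat (unflip (eval-monotone-in (rhs e) r-uniform ⨆≤p (assign-off v))))) })
      (uniforms , ++⁻ʳ (bounds θ p αs) sats)))
      where
      ⨆≤p : (v [ prop p := eval v (⨆ᵗ θ αs) ]) (prop p) ≤⟨ θ ⟩ v (prop p)
      ⨆≤p = subst (_≤⟨ θ ⟩ v (prop p)) (sym (assign-at v))
        (eval-⨆ᵗ-least v θ (Satisfies-bounds⇒ θ p (++⁻ˡ (bounds θ p αs) sats)))

    -- The value of the joined bounds is only known to be closed, while a clopen assignment needs an
    -- element of `A`. The topological Ackermann lemma supplies an `a` in its filter at which the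
    -- other inequalities still hold; lying beyond the closed value, `a` also respects the bounds
    -- `αs`.
    forward : All SynIneq (bounds θ p αs ++ es) →
              (∀ v → Clopen v → Holds v (bounds θ p αs ++ es , I)) →
              ∀ v → Clopen v → Holds v (substituted , I)
    forward syns holds v v-clopen sats =
      conclude (topological-ackermann v-clopen p θ S (++⁻ʳ (bounds θ p αs) syns) uniforms
        (All.map (λ {e} sat → Satisfies-≈ e (λ {x} _ → limit≈ x) (proj₁ (Satisfies-substitute e) sat))
          (map⁻ sats)))
      where
      ⨆-closed : Closed θ (eval v (⨆ᵗ θ αs))
      ⨆-closed = Closed-eval (Syn-⨆ᵗ θ (Syn-bounds θ (++⁻ˡ (bounds θ p αs) syns)))
        λ _ → Closed-atom v-clopen

      S : Pred A.Carrier s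
      S = proj₁ ⨆-closed

      limit≈ : ∀ x → (v [ prop p := eval v (⨆ᵗ θ αs) ]) x ≈ (v [ prop p := K θ S ]) x
      limit≈ x with atom⁺-≟ _≟ₚ_ x (prop p)
      ... | yes _ = proj₂ ⨆-closed
      ... | no _  = E.Eq.refl

      conclude : (∃ λ a → Gen θ S a × All (Satisfies (v [ prop p := ι a ])) es) → Satisfies v I
      conclude (a , Sa , es-sats) = Satisfies-unassign I p∉I (holds _ assigned-clopen
        (++⁺ (Satisfies-bounds⇐ θ p (All.zipWith α≤a (p∉αs , eval-⨆ᵗ-upper v θ αs))) es-sats))
        where
        assigned-clopen : Clopen (v [ prop p := ι a ])
        assigned-clopen = clopen (admissible (nominal (admits v-clopen)) (conominal (admits v-clopen)))
          λ q → assign-elim v {prop p} {y = prop q} (λ u → ∃ λ x → u ≈ ι x)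
            (λ _ → a , E.Eq.refl) (λ _ → proper v-clopen q)

        α≤a : ∀ {α} → ¬ (prop p OccursIn α) × eval v α ≤⟨ θ ⟩ eval v (⨆ᵗ θ αs) →
              eval (v [ prop p := ι a ]) α ≤⟨ θ ⟩ (v [ prop p := ι a ]) (prop p)
        α≤a {α} (p∉α , α≤⨆) = ≤-trans (≤-reflexive (eval-fresh α p∉α))
          (≤-trans α≤⨆ (≤-trans (≤-reflexive (proj₂ ⨆-closed))
            (≤-trans (Gen⇒≤ Sa) (≤-reflexive (E.Eq.reflexive (sym (assign-at v)))))))

  -- Soundness of executions

  All-∼ : ∀ {p} {P : Ineq⁺ → Set p} {S S′} → S ∼[ set ] S′ → All P S → All P S′
  All-∼ S∼S′ all = All.tabulate λ e∈S′ → All.lookup all (Equivalence.from S∼S′ e∈S′)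

  All-∼⁻ : ∀ {p} {P : Ineq⁺ → Set p} {S S′} → S ∼[ set ] S′ → All P S′ → All P S
  All-∼⁻ S∼S′ all = All.tabulate λ e∈S → All.lookup all (Equivalence.to S∼S′ e∈S)

  positive-uniform : ∀ {p e} → PositiveIn (prop p) (lhs e) × NegativeIn (prop p) (rhs e) →
                     UniformIneq + p e
  positive-uniform {e = e} (lhs+ , rhs-) = lhs+ , Uniform-opposite {θ = - } {ρ = + } {t = rhs e} rhs-

  negative-uniform : ∀ {p e} → NegativeIn (prop p) (lhs e) × PositiveIn (prop p) (rhs e) →
                     UniformIneq - p e
  negative-uniform {e = e} (lhs- , rhs+) = lhs- , Uniform-opposite {θ = + } {ρ = + } {t = rhs e} rhs+

  Syn-bound : ∀ σ n γ → SynIneq (bound σ n (embed γ))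
  Syn-bound + n γ = nom n , Syn-embed γ
  Syn-bound - n γ = Syn-embed γ , cnom n

  ⟶-Syn : ∀ {X Y} → X ⟶ Y → All SynIneq (proj₁ X) → All SynIneq (proj₁ Y)
  ⟶-Syn (approxˡ {σ = σ} C γ n _) syns = Syn-bound σ n γ ∷ syns
  ⟶-Syn (approxʳ {σ = σ} C γ n _) syns = Syn-bound σ n γ ∷ syns
  ⟶-Syn (residuation S∼ _ r) syns with e-syn ∷ syns₀ ← All-∼ S∼ syns = Residuates-Syn r e-syn ∷ syns₀
  ⟶-Syn (splitting S∼ _ splits) syns with e-syn ∷ syns₀ ← All-∼ S∼ syns =
    proj₁ (Splits-Syn splits e-syn) ∷ proj₂ (Splits-Syn splits e-syn) ∷ syns₀
  ⟶-Syn (ackermannʳ p αs es S∼ p∉αs p∉I signs) syns =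
    Ackermann.substituted-Syn p∉αs p∉I (All.map positive-uniform signs) (All-∼ S∼ syns)
  ⟶-Syn (ackermannˡ p αs es S∼ p∉αs p∉I signs) syns =
    Ackermann.substituted-Syn p∉αs p∉I (All.map negative-uniform signs) (All-∼ S∼ syns)

  ⟶-forward : ∀ {X Y} → X ⟶ Y → All SynIneq (proj₁ X) →
              (∀ v → Clopen v → Holds v X) → ∀ v → Clopen v → Holds v Y
  ⟶-forward (approxˡ {σ = σ} C γ n _) syns holds v v-clopen (below ∷ sats) =
    ≤-trans (plug-monotone C (Satisfies-bound⇒ σ {γ = embed γ} below)) (holds v v-clopen sats)
  ⟶-forward (approxʳ {σ = σ} C γ n _) syns holds v v-clopen (below ∷ sats) =
    ≤-trans (holds v v-clopen sats) (unflip (plug-monotone C (Satisfies-bound⇒ σ {γ = embed γ} below)))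
  ⟶-forward (residuation S∼ _ r) syns holds v v-clopen (sat ∷ sats) =
    holds v v-clopen (All-∼⁻ S∼ (proj₂ (Residuates-Satisfies r) sat ∷ sats))
  ⟶-forward (splitting S∼ _ splits) syns holds v v-clopen (sat₁ ∷ sat₂ ∷ sats) =
    holds v v-clopen (All-∼⁻ S∼ (Satisfies-unsplit splits sat₁ sat₂ ∷ sats))
  ⟶-forward (ackermannʳ p αs es S∼ p∉αs p∉I signs) syns holds =
    Ackermann.forward p∉αs p∉I (All.map positive-uniform signs) (All-∼ S∼ syns)
      λ v v-clopen sats → holds v v-clopen (All-∼⁻ S∼ sats)
  ⟶-forward (ackermannˡ p αs es S∼ p∉αs p∉I signs) syns holds =
    Ackermann.forward p∉αs p∉I (All.map negative-uniform signs) (All-∼ S∼ syns)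
      λ v v-clopen sats → holds v v-clopen (All-∼⁻ S∼ sats)

  -- The quantifier over assignments stays inside the invariant because approximation changes the
  -- value of the fresh atom.
  ⟶-backward : ∀ {X Y} → X ⟶ Y →
               (∀ v → Admissible v → Holds v Y) → ∀ v → Admissible v → Holds v X
  ⟶-backward (approxˡ C γ n (x∉ , _)) holds = approximateˡ-backward C γ n x∉ holds
  ⟶-backward (approxʳ C γ n (x∉ , _)) holds = approximateʳ-backward C γ n x∉ holds
  ⟶-backward (residuation S∼ _ r) holds v adm sats with sat ∷ sats₀ ← All-∼ S∼ sats =
    holds v adm (proj₁ (Residuates-Satisfies r) sat ∷ sats₀)
  ⟶-backward (splitting S∼ _ splits) holds v adm sats with sat ∷ sats₀ ← All-∼ S∼ sats =
    holds v adm (proj₁ (Satisfies-split splits sat) ∷ proj₂ (Satisfies-split splits sat) ∷ sats₀)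
  ⟶-backward (ackermannʳ p αs es S∼ p∉αs p∉I signs) holds v adm sats =
    Ackermann.backward p∉αs p∉I (All.map positive-uniform signs) holds v adm (All-∼ S∼ sats)
  ⟶-backward (ackermannˡ p αs es S∼ p∉αs p∉I signs) holds v adm sats =
    Ackermann.backward p∉αs p∉I (All.map negative-uniform signs) holds v adm (All-∼ S∼ sats)

  pure-holds : ∀ {X} → PureSystem X →
               (∀ v → Clopen v → Holds v X) → ∀ v → Admissible v → Holds v X
  pure-holds {S , I} (S-pure , I-pure) holds v adm sats =
    Satisfies-≈ I (λ {x} → agree x I-pure) (holds w w-clopen
      (All.zipWith
        (λ { {e} (e-pure , sat) →
          Satisfies-≈ e (λ {x} x∈e → E.Eq.sym (agree x e-pure x∈e)) sat })
        (S-pure , sats)))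
    where
    w : Atom⁺ PROP → Carrier
    -- Any element of `A` would do, as no variable occurs in a pure system.
    w (prop p) = ι A.⊥
    w (nom n)  = v (nom n)
    w (cnom n) = v (cnom n)

    w-clopen : Clopen w
    w-clopen = clopen (admissible (nominal adm) (conominal adm)) λ p → A.⊥ , E.Eq.refl

    agree : ∀ {e} x → PureIneq e → x OccursInIneq e → w x ≈ v x
    agree (prop p) pure p∈e = ⊥-elim (pure p p∈e)
    agree (nom n)  pure _   = E.Eq.refl
    agree (cnom n) pure _   = E.Eq.refl

  -- One recursion makes both passes: the hypothesis is pushed forward before the recursive call,
  -- and its result is pulled back afterwards.
  execution-sound : ∀ {X Y} → Star _⟶ᵖ_ X Y → PureSystem Y → All SynIneq (proj₁ X) →
                    (∀ v → Clopen v → Holds v X) → ∀ v → Admissible v → Holds v X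
  execution-sound Star.ε pure syns holds = pure-holds pure holds
  execution-sound ((step , _) ◅ steps) pure syns holds = ⟶-backward step
    (execution-sound steps pure (⟶-Syn step syns) (⟶-forward step syns holds))

  eval-embed    : ∀ (v : Atom⁺ PROP → Carrier) t → eval v (embed t) ≈ LEStructure.eval Aᵟ (v ∘ prop) t
  evalVec-embed : ∀ (v : Atom⁺ PROP → Carrier) {n} (ts : Vec (Term L PROP) n) i →
                  evalVec v (embedVec ts) i ≈ LEStructure.evalVec Aᵟ (v ∘ prop) ts i

  eval-embed v (atom p)          = E.Eq.refl
  eval-embed v ⊥ᵗ                = E.Eq.refl
  eval-embed v ⊤ᵗ                = E.Eq.refl
  eval-embed v (s ∧ᵗ t)          = ∧-cong (eval-embed v s) (eval-embed v t)
  eval-embed v (s ∨ᵗ t)          = ∨-cong (eval-embed v s) (eval-embed v t)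
  eval-embed v (con (inj₁ f) ts) = op-cong (inj₁ (base f)) (evalVec-embed v ts)
  eval-embed v (con (inj₂ g) ts) = op-cong (inj₂ (base g)) (evalVec-embed v ts)

  evalVec-embed v (t ∷ ts) zero    = eval-embed v t
  evalVec-embed v (t ∷ ts) (suc i) = evalVec-embed v ts i

  eval-ι    : ∀ {v : Atom⁺ PROP → Carrier} {w} → (∀ p → v (prop p) ≈ ι (w p)) → ∀ t →
              eval v (embed t) ≈ ι (A.eval w t)
  evalVec-ι : ∀ {v : Atom⁺ PROP → Carrier} {w} → (∀ p → v (prop p) ≈ ι (w p)) →
              ∀ {n} (ts : Vec (Term L PROP) n) i →
              evalVec v (embedVec ts) i ≈ ι (A.evalVec w ts i)

  eval-ι v≈w (atom p) = v≈w p
  eval-ι v≈w ⊥ᵗ       = E.Eq.sym E.ι-⊥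
  eval-ι v≈w ⊤ᵗ       = E.Eq.sym E.ι-⊤
  eval-ι v≈w (s ∧ᵗ t) = E.Eq.trans (∧-cong (eval-ι v≈w s) (eval-ι v≈w t)) (E.Eq.sym (E.ι-∧ _ _))
  eval-ι v≈w (s ∨ᵗ t) = E.Eq.trans (∨-cong (eval-ι v≈w s) (eval-ι v≈w t)) (E.Eq.sym (E.ι-∨ _ _))
  eval-ι v≈w (con (inj₁ f) ts) =
    E.Eq.trans (op-cong (inj₁ (base f)) (evalVec-ι v≈w ts)) (Opᵟ.fᵉ-ι (inj₁ f) _)
  eval-ι v≈w (con (inj₂ g) ts) =
    E.Eq.trans (op-cong (inj₂ (base g)) (evalVec-ι v≈w ts)) (Opᵟ.fᵉ-ι (inj₂ g) _)

  evalVec-ι v≈w (t ∷ ts) zero    = eval-ι v≈w t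
  evalVec-ι v≈w (t ∷ ts) (suc i) = evalVec-ι v≈w ts i

  succeeds-canonical : ∀ {e X} → Star _⟶ᵖ_ ([] , embedIneq e) X → PureSystem X →
                       LEAlgebra.structure A ⊨ e → Aᵟ ⊨ e
  succeeds-canonical {φ ≼ ψ} execution pure A⊨e v = pos⁻¹
    (≤-trans (≤-reflexive (E.Eq.sym (eval-embed v⁺ φ)))
      (≤-trans (execution-sound execution pure [] initial v⁺ v⁺-admissible [])
        (≤-reflexive (eval-embed v⁺ ψ))))
    where
    v⁺ : Atom⁺ PROP → Carrier
    v⁺ (prop p) = v p
    -- The initial system contains no nominals or co-nominals; `ι A.⊥` is both closed and open.
    v⁺ (nom _)  = ι A.⊥
    v⁺ (cnom _) = ι A.⊥

    v⁺-admissible : Admissible v⁺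
    v⁺-admissible = admissible (λ _ → Closed-ι { + } A.⊥) (λ _ → Closed-ι { - } A.⊥)

    initial : ∀ v → Clopen v → Holds v ([] , embedIneq (φ ≼ ψ))
    initial v v-clopen [] =
      ≤-trans (≤-reflexive (eval-ι v≈ φ))
        (≤-trans (ι-mono (𝔸.pos (A⊨e _))) (≤-reflexive (E.Eq.sym (eval-ι v≈ ψ))))
      where
      v≈ : ∀ p → v (prop p) ≈ ι (proj₁ (proper v-clopen p))
      v≈ p = proj₂ (proper v-clopen p)

theorem7p1 : ∀ {o : Level} (L : Language o) (e : Ineq L (Language.PROP L)) →
    SucceedsPivotally L e →
    ∀ {a ℓ₁ ℓ₂ c e₁ e₂ : Level} (A : LEAlgebra L a ℓ₁ ℓ₂)
    (E : CanonicalExtension (LEAlgebra.boundedLattice A) c e₁ e₂) →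
    LEAlgebra.structure A ⊨ e → canonicalExtension A E ⊨ e
theorem7p1 L e (es , preprocesses , executions) A E A⊨e v = Signed.pos⁻¹ completion
  -- Stage 1 is applied in the algebra, Stage 2 carries each resulting inequality over to the
  -- extension, and there Stage 1 is undone.
  (proj₂ (Aᵟ.Preprocesses-valid preprocesses)
    (All.zipWith
      (λ { ((X , execution , pure) , valid) v → Signed.pos
        (succeeds-canonical execution pure (λ w → Signed.pos⁻¹ boundedLattice (valid w)) v) })
      (executions , proj₁ (A.Preprocesses-valid preprocesses) (λ w → Signed.pos (A⊨e w))))
    v)
  where
  open Reduction A E using (succeeds-canonical)
  open CanonicalExtension E using (completion)
  open LEAlgebra A using (structure; boundedLattice)
  open SignedAlgebra A using (op-monotone; op-joins)
  open Expansion A E using (opᵟ-monotone; opᵟ-joins)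
  module A = PreprocessingSound structure op-monotone op-joins
  module Aᵟ = PreprocessingSound (canonicalExtension A E) opᵟ-monotone opᵟ-joins
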